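{- There exist a constant $c>0$ and a function $q:\mathbb{N}\to\mathbb{N}$ such that for every $k\in\mathbb{N}$ (with $k\ge 1$) and all sufficiently large $t$ (depending on $k$) the following hold: (a) $r_{2k+1}\big(\hat H_t^{(2k+1)};2\big)\le t^{k+3}$; and (b) if $k\geq 2$ and $\lfloor c\log_2\log_2 k\rfloor\ge 1$, then $r_{2k+1}\big(\hat H_t^{(2k+1)};q(k)\big)\ge T_{\lfloor c\log_2\log_2 k\rfloor}(t)$.
   Context: $K_n^{(k)}$ is the complete $k$-uniform hypergraph on $n$ vertices. For a $k$-uniform hypergraph $G$ and $q\in\mathbb N$, $r_k(G;q)$ is the smallest integer $n$ such that in every colouring of the edges of $K_n^{(k)}$ with $q$ colours there is a (not necessarily induced) copy of $G$ all of whose edges have the same colour. The $k$-uniform balanced hedgehog $\hat H_t^{(k)}$ with body of order $t$ is the following $k$-uniform hypergraph: take a set $S$ of $t$ vertices (the body), and for each subset $X\subset S$ with $|X|=\lceil k/2\rceil$ add one $k$-edge $e$ with $e\cap S=X$, in such a way that any two distinct edges $e,f$ satisfy $e\cap f\subset S$. The vertex set consists of $S$ and the vertices of these edges. (So $\hat H_t^{(2k+1)}$ has one edge for each $(k+1)$-subset of its body.) The tower function is defined by $T_1(x)=x$ and $T_{i+1}(x)=2^{T_i(x)}$. -}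

module Defs where

open import Data.Fin.Base using (Fin; zero; suc)
open import Data.Fin.Properties using (+↔⊎)
open import Data.Fin.Subset using (Subset; inside; outside; ∣_∣) renaming (_∈_ to _∈ˢ_)
open import Data.Integer.Base using () renaming (∣_∣ to abs)
open import Data.Nat.Base using (ℕ; zero; suc; _+_; _*_; _^_; _≤_; NonZero; ⌊_/2⌋; ⌈_/2⌉)
open import Data.Nat.Properties using (+-comm; ⌊n/2⌋+⌈n/2⌉≡n)
open import Data.Product.Base using (∃; _×_; _,_)
open import Data.Rational.Base using (ℚ; ↥_; ↧ₙ_)
open import Data.Sum.Base using (_⊎_; inj₁; inj₂)
open import Data.Sum.Function.Propositional using (_⊎-↔_)
open import Data.Vec.Base using ([]; _∷_; here; there)
open import Data.Vec.Properties.WithK using ([]=-irrelevant)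
open import Function.Base using (_∘_)
open import Function.Bundles using (_↔_; _⇔_; mk↔ₛ′)
open import Function.Construct.Composition using (_↔-∘_)
open import Function.Construct.Identity using (↔-id)
open import Function.Construct.Symmetry using (↔-sym)
open import Function.Definitions using (Injective)
open import Relation.Binary.PropositionalEquality using (_≡_; refl; cong; subst; trans)
open import Relation.Binary.PropositionalEquality.WithK using (≡-irrelevant)
open import Relation.Nullary using (¬_; Irrelevant)

record Hypergraph (k : ℕ) : Set₁ where
  field
    Vertex       : Set
    Edge         : Set
    _∈_          : Vertex → Edge → Set
    ∈-irrelevant : ∀ {v e} → Irrelevant (v ∈ e)
    uniform      : ∀ e → ∃ (λ v → v ∈ e) ↔ Fin k

open Hypergraph using (Vertex; Edge)

∈ˢ↔Fin : ∀ {n} (X : Subset n) → ∃ (λ i → i ∈ˢ X) ↔ Fin ∣ X ∣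
∈ˢ↔Fin X = mk↔ₛ′ (to X) (from X) (to∘from X) (from∘to X)
  where
  to : ∀ {n} (X : Subset n) → ∃ (λ i → i ∈ˢ X) → Fin ∣ X ∣
  to (inside  ∷ X) (zero  , here)    = zero
  to (inside  ∷ X) (suc i , there p) = suc (to X (i , p))
  to (outside ∷ X) (suc i , there p) = to X (i , p)

  shift : ∀ {n s} {X : Subset n} → ∃ (λ i → i ∈ˢ X) → ∃ (λ i → i ∈ˢ (s ∷ X))
  shift (i , p) = suc i , there p

  from : ∀ {n} (X : Subset n) → Fin ∣ X ∣ → ∃ (λ i → i ∈ˢ X)
  from (inside  ∷ X) zero    = zero , here
  from (inside  ∷ X) (suc j) = shift (from X j)
  from (outside ∷ X) j       = shift (from X j)

  to∘from : ∀ {n} (X : Subset n) j → to X (from X j) ≡ j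
  to∘from (inside  ∷ X) zero    = refl
  to∘from (inside  ∷ X) (suc j) = cong suc (to∘from X j)
  to∘from (outside ∷ X) j       = to∘from X j

  from∘to : ∀ {n} (X : Subset n) p → from X (to X p) ≡ p
  from∘to (inside  ∷ X) (zero  , here)    = refl
  from∘to (inside  ∷ X) (suc i , there p) = cong shift (from∘to X (i , p))
  from∘to (outside ∷ X) (suc i , there p) = cong shift (from∘to X (i , p))

_choose_ : ℕ → ℕ → Set
n choose m = ∃ λ (X : Subset n) → ∣ X ∣ ≡ m

K[_] : (n k : ℕ) → Hypergraph k
K[ n ] k = record
  { Vertex       = Fin n
  ; Edge         = n choose k
  ; _∈_          = λ { i (X , _) → i ∈ˢ X }
  ; ∈-irrelevant = []=-irrelevant
  ; uniform      = λ { (X , ∣X∣≡k) →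
                       subst (λ m → ∃ (λ i → i ∈ˢ X) ↔ Fin m) ∣X∣≡k (∈ˢ↔Fin X) }
  }

-- The edge indexed by X consists of X together with ⌊ k /2⌋ vertices
-- inj₂ (X , j) of its own, so distinct edges only meet inside the body Fin t.
balancedHedgehog : (k t : ℕ) → Hypergraph k
balancedHedgehog k t = record
  { Vertex       = Fin t ⊎ (t choose ⌈ k /2⌉ × Fin ⌊ k /2⌋)
  ; Edge         = t choose ⌈ k /2⌉
  ; _∈_          = _∈_
  ; ∈-irrelevant = λ {v} → irrelevant v
  ; uniform      = λ X → subst (λ m → ∃ (λ v → v ∈ X) ↔ Fin m) halves (count X)
  }
  where
  _∈_ : Fin t ⊎ (t choose ⌈ k /2⌉ × Fin ⌊ k /2⌋) → t choose ⌈ k /2⌉ → Set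
  inj₁ s       ∈ (X , _) = s ∈ˢ X
  inj₂ (Y , _) ∈ X       = Y ≡ X

  irrelevant : ∀ v {X} → Irrelevant (v ∈ X)
  irrelevant (inj₁ _) = []=-irrelevant
  irrelevant (inj₂ _) = ≡-irrelevant

  halves : ⌈ k /2⌉ + ⌊ k /2⌋ ≡ k
  halves = trans (+-comm ⌈ k /2⌉ ⌊ k /2⌋) (⌊n/2⌋+⌈n/2⌉≡n k)

  split : ∀ X → ∃ (λ v → v ∈ X) ↔ (∃ (λ i → inj₁ i ∈ X) ⊎ Fin ⌊ k /2⌋)
  split X = mk↔ₛ′
    (λ { (inj₁ s , p)          → inj₁ (s , p)
       ; (inj₂ (_ , j) , _)    → inj₂ j })
    (λ { (inj₁ (s , p))        → inj₁ s , p
       ; (inj₂ j)              → inj₂ (X , j) , refl })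
    (λ { (inj₁ _)              → refl
       ; (inj₂ _)              → refl })
    (λ { (inj₁ _ , _)          → refl
       ; (inj₂ (_ , _) , refl) → refl })

  count : ∀ X → ∃ (λ v → v ∈ X) ↔ Fin (⌈ k /2⌉ + ⌊ k /2⌋)
  count X = ↔-sym +↔⊎ ↔-∘ ((Hypergraph.uniform (K[ t ] ⌈ k /2⌉) X ⊎-↔ ↔-id _) ↔-∘ split X)

Colouring : ∀ {k} → Hypergraph k → ℕ → Set
Colouring H q = Edge H → Fin q

-- A not necessarily induced copy of G in H; covers says that onEdges e is the
-- image of e under onVertices.
record Copy {k} (G H : Hypergraph k) : Set where
  private
    module G = Hypergraph G
    module H = Hypergraph H
  field
    onVertices : G.Vertex → H.Vertex
    injective  : Injective _≡_ _≡_ onVertices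
    onEdges    : G.Edge → H.Edge
    covers     : ∀ e w → w H.∈ onEdges e ⇔ ∃ λ v → v G.∈ e × onVertices v ≡ w

Monochromatic : ∀ {k q} {G H : Hypergraph k} → Colouring H q → Copy G H → Set
Monochromatic χ C = ∀ e f → χ (onEdges e) ≡ χ (onEdges f)
  where open Copy C

Forces : ∀ {k} → Hypergraph k → (q n : ℕ) → Set
Forces {k} G q n = ∀ (χ : Colouring (K[ n ] k) q) → ∃ λ (C : Copy G (K[ n ] k)) → Monochromatic χ C

IsRamseyNumber : ∀ {k} → Hypergraph k → (q r : ℕ) → Set
IsRamseyNumber G q r = Forces G q r × (∀ n → Forces G q n → r ≤ n)

-- Only indices i ≥ 1 are meaningful; the value at 0 is arbitrary.
tower : ℕ → ℕ → ℕ
tower zero          x = x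
tower (suc zero)    x = x
tower (suc (suc i)) x = 2 ^ tower (suc i) x

-- The next two relations express inequalities between a rational a / b ≥ 0 and
-- a real logarithm, for b ≥ 1 and k ≥ 2.  Here a / b ≤ log₂ k iff 2 ^ a ≤ k ^ b.
_/_≤log₂_ : ℕ → ℕ → ℕ → Set
a / b ≤log₂ k = 2 ^ a ≤ k ^ b

-- a / b ≤ log₂ (log₂ k) iff the real number 2 ^ (a / b) is at most log₂ k, iff
-- every rational p / s ≤ 2 ^ (a / b), i.e. with (p / s) ^ b ≤ 2 ^ a, is.
_/_≤log₂log₂_ : ℕ → ℕ → ℕ → Set
a / b ≤log₂log₂ k = ∀ p s → .{{NonZero s}} → p ^ b ≤ 2 ^ a * s ^ b → p / s ≤log₂ k

-- m ≤ c * log₂ (log₂ k) for a rational c > 0, i.e. m / c ≤ log₂ (log₂ k).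
_≤_*log₂log₂_ : ℕ → ℚ → ℕ → Set
m ≤ c *log₂log₂ k = (m * ↧ₙ c) / abs (↥ c) ≤log₂log₂ k

-- m = ⌊ c * log₂ (log₂ k) ⌋ for c > 0 and k ≥ 2.
_≡⌊_*log₂log₂_⌋ : ℕ → ℚ → ℕ → Set
m ≡⌊ c *log₂log₂ k ⌋ = m ≤ c *log₂log₂ k × ¬ (suc m ≤ c *log₂log₂ k)

{-# OPTIONS --safe #-}
module Submission where

-- Upper bound.  Call a set X of ⌈K/2⌉ vertices bad for a colour c if boundedly
-- many vertices meet the rest of every c-coloured edge through X.  An edge through
-- a set bad for one colour and a set bad for the other, avoiding both obstacles, has
-- no colour; so each vertex v has a colour c for which the bad sets with least
-- element v contain no long sunflower with core {v}, and thus are covered by few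
-- vertices other than v.  Half of the vertices share c, and a greedy choice in
-- increasing order yields a body without bad sets, to which the edges are attached
-- one at a time.
--
-- Lower bound.  It suffices to find families of sets of at most k + 1 vertices, each
-- hitting every t-set, such that every edge misses some family: colour the edge by
-- that family.  Stepping up from n to 2 ^ n vertices, view the new vertices as the
-- leaves of a binary tree.  A large set of leaves has either a path with many
-- branchings, whose levels are hit by each old family, or a large complete binary
-- subtree, which contains any given small shape.  An edge has too few leaves to
-- contain two opposite combs and a complete tree, and its branching levels miss some
-- old family; so the pairs (shape, old family) index suitable new families.

open import Defs
open import Data.Bool.Base using (Bool; true; false; _∧_)
open import Data.Empty using (⊥)
open import Data.Fin.Base using (Fin; zero; suc; inject≤; combine; remQuot) renaming (_≤_ to _≤ᶠ_; _<_ to _<ᶠ_)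
open import Data.Fin.Properties
  using (any?; all?; +↔⊎; *↔×; inject≤-injective; injective⇒≤; remQuot-combine)
  renaming (_≟_ to _≟ᶠ_; _≤?_ to _≤ᶠ?_; ≤∧≢⇒< to ≤∧≢⇒<ᶠ)
open import Data.Fin.Subset using (Subset; inside; outside; ∣_∣; _⊆_; _∪_; _∩_; ∁; ⁅_⁆)
  renaming (_∈_ to _∈ˢ_; _∉_ to _∉ˢ_; ⊥ to ∅; ⊤ to univ)
open import Data.Fin.Subset.Properties
open import Data.Integer.Base using () renaming (+_ to pos)
open import Data.Nat.Base
open import Data.Nat.DivMod using (_/_; _%_; m≡m%n+[m/n]*n; m%n<n; m*n/n≡m; /-monoˡ-≤; m/n*n≤m)
open import Data.Nat.Properties
open import Data.Nat.Tactic.RingSolver using (solve-∀)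
open import Data.Product.Base as Product using (∃; ∃₂; _×_; _,_; proj₁; proj₂)
open import Data.Product.Properties using (,-injectiveˡ; ,-injectiveʳ)
open import Data.Rational.Base using (ℚ; 0ℚ) renaming (_<_ to _<ℚ_; _/_ to _/ℚ_)
open import Data.Rational.Properties using () renaming (_<?_ to _<ℚ?_)
open import Data.Sum.Base as Sum using (_⊎_; inj₁; inj₂; [_,_]′)
open import Data.Sum.Properties using (inj₁-injective; inj₂-injective)
open import Data.Vec.Base using (Vec; []; _∷_; _++_; take; drop; lookup; tabulate; here; there)
open import Data.Vec.Properties using (lookup∘tabulate; []=⇒lookup; lookup⇒[]=; take++drop≡id; ++-injective)
open import Data.Vec.Properties.WithK using ([]=-irrelevant)
open import Function.Base using (_∘_; id; case_of_)
open import Function.Bundles using (Inverse; Injection; Equivalence; _⇔_; mk⇔; _↔_)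
open import Function.Construct.Symmetry using (↔-sym)
open import Function.Definitions using (Injective)
open import Function.Properties.Inverse using (↔⇒↣)
open import Relation.Binary.PropositionalEquality
open import Relation.Nullary using (¬_; Dec; yes; no; does; contradiction)
open import Relation.Nullary.Decidable using (map′; _⊎-dec_; _×-dec_; _→-dec_; ¬?; decidable-stable; dec-true; toWitness)
open import Relation.Unary using (Decidable)

-- Arithmetic

-- Reduces an inequality to a known one and an identity for `solve-∀`; `s` is the slack, so that no
-- subtraction occurs.
≤-by : ∀ {l r x y} s → l ≤ r → x + r + s ≡ y + l → x ≤ y
≤-by {l} {r} {x} {y} s l≤r eq = +-cancelʳ-≤ r x y (begin
  x + r      ≤⟨ m≤m+n (x + r) s ⟩
  x + r + s  ≡⟨ eq ⟩
  y + l      ≤⟨ +-monoʳ-≤ y l≤r ⟩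
  y + r      ∎)
  where open ≤-Reasoning

n<2^n : ∀ n → n < 2 ^ n
n<2^n zero    = s≤s z≤n
n<2^n (suc n) = begin-strict
  suc n            <⟨ s≤s (n<2^n n) ⟩
  1 + 2 ^ n        ≤⟨ +-monoˡ-≤ (2 ^ n) (m^n>0 2 n) ⟩
  2 ^ n + 2 ^ n    ≡⟨ cong (2 ^ n +_) (+-identityʳ (2 ^ n)) ⟨
  2 ^ suc n        ∎
  where open ≤-Reasoning

log₂ : ∀ t → 1 ≤ t → ∃ λ n → 2 ^ n ≤ t × t < 2 ^ suc n
log₂ (suc zero)    _ = 0 , ≤-refl , ≤-refl
log₂ (suc (suc t)) _ with n , lo , hi ← log₂ (suc t) (s≤s z≤n) with suc (suc t) <? 2 ^ suc n
... | yes hi′ = n , ≤-trans lo (n≤1+n _) , hi′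
... | no ≮    = suc n , ≮⇒≥ ≮ , ≤-<-trans hi (^-monoʳ-< 2 ≤-refl (n<1+n (suc n)))

-- With n = q F + r, F = 2 E + 1 and q large, n + 3 ≤ (F + 2) 2 ^ q ≤ 2 ^ (2 q).
polynomial≤exponential : ∀ E → ∃ λ n₀ → ∀ n → n₀ ≤ n → (3 + n) ^ E ≤ 2 ^ n
polynomial≤exponential E = (2 + F) * F , bound
  where
  open ≤-Reasoning
  F = suc (E + E)
  bound : ∀ n → (2 + F) * F ≤ n → (3 + n) ^ E ≤ 2 ^ n
  bound n n₀≤n = begin
    (3 + n) ^ E               ≤⟨ ^-monoˡ-≤ E 3+n≤ ⟩
    (2 ^ (q + q)) ^ E         ≡⟨ ^-*-assoc 2 (q + q) E ⟩
    2 ^ ((q + q) * E)         ≤⟨ ^-monoʳ-≤ 2 (≤-trans (≤-reflexive (eq₁ q E)) (m≤n+m _ q)) ⟩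
    2 ^ (q + q * (E + E))     ≡⟨ cong (2 ^_) (*-suc q (E + E)) ⟨
    2 ^ (q * F)               ≤⟨ ^-monoʳ-≤ 2 (m/n*n≤m n F) ⟩
    2 ^ n                     ∎
    where
    q = n / F
    eq₁ : ∀ q E → (q + q) * E ≡ q * (E + E)
    eq₁ = solve-∀
    eq₂ : ∀ q F → 3 + (F + q * F) + q * 2 + 0 ≡ suc ((2 + F) * suc q)
    eq₂ = solve-∀
    2+F≤q : 2 + F ≤ q
    2+F≤q = ≤-trans (≤-reflexive (sym (m*n/n≡m (2 + F) F))) (/-monoˡ-≤ F n₀≤n)
    3+n≤ : 3 + n ≤ 2 ^ (q + q)
    3+n≤ = s≤s⁻¹ (begin
      4 + n                         ≡⟨ cong (4 +_) (m≡m%n+[m/n]*n n F) ⟩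
      4 + (n % F + q * F)           ≡⟨⟩
      3 + (suc (n % F) + q * F)     ≤⟨ +-monoʳ-≤ 3 (+-monoˡ-≤ (q * F) (m%n<n n F)) ⟩
      3 + (F + q * F)               ≤⟨ m≤m+n _ (q * 2) ⟩
      3 + (F + q * F) + q * 2       ≡⟨ +-identityʳ _ ⟨
      3 + (F + q * F) + q * 2 + 0   ≡⟨ eq₂ q F ⟩
      suc ((2 + F) * suc q)         ≤⟨ s≤s (*-mono-≤ (≤-trans 2+F≤q (<⇒≤ (n<2^n q))) (n<2^n q)) ⟩
      suc (2 ^ q * 2 ^ q)           ≡⟨ cong suc (^-distribˡ-+-* 2 q q) ⟨
      suc (2 ^ (q + q))             ∎)

-- Finite sets

to-injective : ∀ {A B : Set} (e : A ↔ B) → Injective _≡_ _≡_ (Inverse.to e)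
to-injective e = Injection.injective (↔⇒↣ e)

∃∈-≡ : ∀ {n} {p : Subset n} {x y : ∃ λ i → i ∈ˢ p} → proj₁ x ≡ proj₁ y → x ≡ y
∃∈-≡ {x = i , i∈p} {.i , i∈p′} refl = cong (i ,_) ([]=-irrelevant i∈p i∈p′)

injection⇒∣∣≤ : ∀ {m n} (p : Subset m) (q : Subset n) (f : ∀ i → i ∈ˢ p → ∃ λ j → j ∈ˢ q) →
                (∀ i j (i∈p : i ∈ˢ p) (j∈p : j ∈ˢ p) → proj₁ (f i i∈p) ≡ proj₁ (f j j∈p) → i ≡ j) →
                ∣ p ∣ ≤ ∣ q ∣
injection⇒∣∣≤ p q f f-inj = injective⇒≤ {f = Inverse.to (∈ˢ↔Fin q) ∘ f′ ∘ Inverse.from (∈ˢ↔Fin p)}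
  λ eq → to-injective (↔-sym (∈ˢ↔Fin p)) (∃∈-≡ (f-inj _ _ _ _ (cong proj₁ (to-injective (∈ˢ↔Fin q) eq))))
  where
  f′ : (∃ λ i → i ∈ˢ p) → ∃ λ j → j ∈ˢ q
  f′ (i , i∈p) = f i i∈p

image : ∀ {m n} → (Fin m → Fin n) → Subset m → Subset n
image f []            = ∅
image f (inside ∷ p)  = ⁅ f zero ⁆ ∪ image (f ∘ suc) p
image f (outside ∷ p) = image (f ∘ suc) p

∈-image⁺ : ∀ {m n} (f : Fin m → Fin n) {p i} → i ∈ˢ p → f i ∈ˢ image f p
∈-image⁺ f {inside ∷ p}  here       = x∈p∪q⁺ (inj₁ (x∈⁅x⁆ (f zero)))
∈-image⁺ f {inside ∷ p}  (there i∈) = x∈p∪q⁺ (inj₂ (∈-image⁺ (f ∘ suc) i∈))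
∈-image⁺ f {outside ∷ p} (there i∈) = ∈-image⁺ (f ∘ suc) i∈

∈-image⁻ : ∀ {m n} (f : Fin m → Fin n) p {x} → x ∈ˢ image f p → ∃ λ i → i ∈ˢ p × f i ≡ x
∈-image⁻ f []            x∈ = contradiction x∈ ∉⊥
∈-image⁻ f (inside ∷ p)  x∈ with x∈p∪q⁻ ⁅ f zero ⁆ _ x∈
... | inj₁ x∈⁅⁆ = zero , here , sym (x∈⁅y⁆⇒x≡y _ x∈⁅⁆)
... | inj₂ x∈′ with i , i∈p , eq ← ∈-image⁻ (f ∘ suc) p x∈′ = suc i , there i∈p , eq
∈-image⁻ f (outside ∷ p) x∈ with i , i∈p , eq ← ∈-image⁻ (f ∘ suc) p x∈ = suc i , there i∈p , eq

∣image∣ : ∀ {m n} (f : Fin m → Fin n) → Injective _≡_ _≡_ f → ∀ p → ∣ image f p ∣ ≡ ∣ p ∣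
∣image∣ f f-inj p = ≤-antisym
  (injection⇒∣∣≤ _ p (λ x x∈ → let i , i∈p , _ = ∈-image⁻ f p x∈ in i , i∈p)
    λ x y x∈ y∈ eq → trans (sym (proj₂ (proj₂ (∈-image⁻ f p x∈))))
                       (trans (cong f eq) (proj₂ (proj₂ (∈-image⁻ f p y∈)))))
  (injection⇒∣∣≤ p _ (λ i i∈ → f i , ∈-image⁺ f i∈) λ _ _ _ _ → f-inj)

preimage : ∀ {m n} → (Fin m → Fin n) → Subset n → Subset m
preimage f p = tabulate (lookup p ∘ f)

∈-preimage⁺ : ∀ {m n} (f : Fin m → Fin n) {p i} → f i ∈ˢ p → i ∈ˢ preimage f p
∈-preimage⁺ f {p} {i} fi∈p = lookup⇒[]= i _ (trans (lookup∘tabulate (lookup p ∘ f) i) ([]=⇒lookup fi∈p))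

∈-preimage⁻ : ∀ {m n} (f : Fin m → Fin n) {p i} → i ∈ˢ preimage f p → f i ∈ˢ p
∈-preimage⁻ f {p} {i} i∈ = lookup⇒[]= (f i) p (trans (sym (lookup∘tabulate (lookup p ∘ f) i)) ([]=⇒lookup i∈))

∣preimage∣≤ : ∀ {m n} (f : Fin m → Fin n) → Injective _≡_ _≡_ f → ∀ p → ∣ preimage f p ∣ ≤ ∣ p ∣
∣preimage∣≤ f f-inj p = injection⇒∣∣≤ _ p (λ i i∈ → f i , ∈-preimage⁻ f i∈) λ _ _ _ _ → f-inj

-- Serves both to enlarge a small generator to the index of a hedgehog edge and to complete two bad
-- sets to an edge inside the permitted vertices.
interpolate : ∀ {n} m (p q : Subset n) → p ⊆ q → ∣ p ∣ ≤ m → m ≤ ∣ q ∣ →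
              ∃ λ z → p ⊆ z × z ⊆ q × ∣ z ∣ ≡ m
interpolate zero    []            []            _   _  _  = [] , id , id , refl
interpolate (suc m) (inside ∷ p)  (inside ∷ q)  p⊆q (s≤s ≤m) (s≤s m≤)
  with z , p⊆z , z⊆q , ∣z∣ ← interpolate m p q (drop-∷-⊆ p⊆q) ≤m m≤ =
  inside ∷ z , s⊆s p⊆z , s⊆s z⊆q , cong suc ∣z∣
interpolate m       (inside ∷ p)  (outside ∷ q) p⊆q _ _ with () ← p⊆q here
interpolate m       (outside ∷ p) (outside ∷ q) p⊆q ≤m m≤
  with z , p⊆z , z⊆q , ∣z∣ ← interpolate m p q (drop-∷-⊆ p⊆q) ≤m m≤ =
  outside ∷ z , s⊆s p⊆z , s⊆s z⊆q , ∣z∣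
interpolate m       (outside ∷ p) (inside ∷ q)  p⊆q ≤m m≤ with m ≤? ∣ q ∣
-- Here `m` exceeds `∣ q ∣`, so it equals `suc ∣ q ∣` and the whole of `inside ∷ q` is taken.
... | no m≰ = inside ∷ q , p⊆q , id , ≤-antisym (≰⇒> m≰) m≤
... | yes m≤′ with z , p⊆z , z⊆q , ∣z∣ ← interpolate m p q (drop-∷-⊆ p⊆q) ≤m m≤′ =
  outside ∷ z , s⊆s p⊆z , out⊆ z⊆q , ∣z∣

image⊆ : ∀ {m n} (f : Fin m → Fin n) p {q} → (∀ {i} → i ∈ˢ p → f i ∈ˢ q) → image f p ⊆ q
image⊆ f p f∈q x∈ with i , i∈p , refl ← ∈-image⁻ f p x∈ = f∈q i∈p

⊆image : ∀ {m n} (f : Fin m → Fin n) r {p q} → q ⊆ image f r → preimage f q ⊆ p → q ⊆ image f p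
⊆image f r q⊆ ⊆p x∈q with i , _ , refl ← ∈-image⁻ f r (q⊆ x∈q) = ∈-image⁺ f (⊆p (∈-preimage⁺ f x∈q))

∣∪∣+∣∩∣ : ∀ {n} (p q : Subset n) → ∣ p ∪ q ∣ + ∣ p ∩ q ∣ ≡ ∣ p ∣ + ∣ q ∣
∣∪∣+∣∩∣ []            []            = refl
∣∪∣+∣∩∣ (inside ∷ p)  (inside ∷ q)  =
  cong suc (trans (+-suc _ _) (trans (cong suc (∣∪∣+∣∩∣ p q)) (sym (+-suc _ _))))
∣∪∣+∣∩∣ (inside ∷ p)  (outside ∷ q) = cong suc (∣∪∣+∣∩∣ p q)
∣∪∣+∣∩∣ (outside ∷ p) (inside ∷ q)  = trans (cong suc (∣∪∣+∣∩∣ p q)) (sym (+-suc _ _))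
∣∪∣+∣∩∣ (outside ∷ p) (outside ∷ q) = ∣∪∣+∣∩∣ p q

∣∪∣≤ : ∀ {n} (p q : Subset n) → ∣ p ∪ q ∣ ≤ ∣ p ∣ + ∣ q ∣
∣∪∣≤ p q = subst (∣ p ∪ q ∣ ≤_) (∣∪∣+∣∩∣ p q) (m≤m+n _ _)

∈⇒1≤∣∣ : ∀ {n x} {p : Subset n} → x ∈ˢ p → 1 ≤ ∣ p ∣
∈⇒1≤∣∣ {x = x} {p} x∈p = ≤-trans (≤-reflexive (sym (∣⁅x⁆∣≡1 x)))
  (p⊆q⇒∣p∣≤∣q∣ λ y∈ → subst (_∈ˢ p) (sym (x∈⁅y⁆⇒x≡y x y∈)) x∈p)

∣∩∁∣+∣∣ : ∀ {n} (p q : Subset n) → q ⊆ p → ∣ p ∩ ∁ q ∣ + ∣ q ∣ ≡ ∣ p ∣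
∣∩∁∣+∣∣ []            []            _   = refl
∣∩∁∣+∣∣ (inside ∷ p)  (inside ∷ q)  q⊆p = trans (+-suc _ _) (cong suc (∣∩∁∣+∣∣ p q (drop-∷-⊆ q⊆p)))
∣∩∁∣+∣∣ (inside ∷ p)  (outside ∷ q) q⊆p = cong suc (∣∩∁∣+∣∣ p q (drop-∷-⊆ q⊆p))
∣∩∁∣+∣∣ (outside ∷ p) (inside ∷ q)  q⊆p with () ← q⊆p here
∣∩∁∣+∣∣ (outside ∷ p) (outside ∷ q) q⊆p = ∣∩∁∣+∣∣ p q (drop-∷-⊆ q⊆p)

∣p∣≤∣p∩∁q∣+∣q∣ : ∀ {n} (p q : Subset n) → ∣ p ∣ ≤ ∣ p ∩ ∁ q ∣ + ∣ q ∣
∣p∣≤∣p∩∁q∣+∣q∣ p q = ≤-trans (p⊆q⇒∣p∣≤∣q∣ p⊆) (∣∪∣≤ (p ∩ ∁ q) q)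
  where
  p⊆ : p ⊆ (p ∩ ∁ q) ∪ q
  p⊆ {x} x∈p with x ∈? q
  ... | yes x∈q = x∈p∪q⁺ (inj₂ x∈q)
  ... | no x∉q  = x∈p∪q⁺ (inj₁ (x∈p∩q⁺ (x∈p , x∉p⇒x∈∁p x∉q)))

comprehension : ∀ {n} {P : Fin n → Set} → Decidable P → Subset n
comprehension P? = tabulate (does ∘ P?)

module _ {n} {P : Fin n → Set} (P? : Decidable P) where

  ∈-comprehension⁺ : ∀ {i} → P i → i ∈ˢ comprehension P?
  ∈-comprehension⁺ {i} p = lookup⇒[]= i _ (trans (lookup∘tabulate (does ∘ P?) i) (dec-true (P? i) p))

  ∈-comprehension⁻ : ∀ {i} → i ∈ˢ comprehension P? → P i
  ∈-comprehension⁻ {i} i∈ with P? i | trans (sym (lookup∘tabulate (does ∘ P?) i)) ([]=⇒lookup i∈)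
  ... | yes p | _ = p

leastElement : ∀ {n} (p : Subset n) → 1 ≤ ∣ p ∣ → ∃ λ v → v ∈ˢ p × (∀ {x} → x ∈ˢ p → v ≤ᶠ x)
leastElement (inside ∷ p)  _   = zero , here , λ _ → z≤n
leastElement (outside ∷ p) 1≤p with v , v∈p , least ← leastElement p 1≤p =
  suc v , there v∈p , λ { (there x∈p) → s≤s (least x∈p) }

∣p++q∣≡∣p∣+∣q∣ : ∀ {m n} (p : Subset m) (q : Subset n) → ∣ p ++ q ∣ ≡ ∣ p ∣ + ∣ q ∣
∣p++q∣≡∣p∣+∣q∣ []            q = refl
∣p++q∣≡∣p∣+∣q∣ (inside ∷ p)  q = cong suc (∣p++q∣≡∣p∣+∣q∣ p q)
∣p++q∣≡∣p∣+∣q∣ (outside ∷ p) q = ∣p++q∣≡∣p∣+∣q∣ p q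

++-⊆⁻ˡ : ∀ {m n} (p q : Subset m) {p′ q′ : Subset n} → p ++ p′ ⊆ q ++ q′ → p ⊆ q
++-⊆⁻ˡ (_ ∷ p) (_ ∷ q) h here with here ← h here = here
++-⊆⁻ˡ (_ ∷ p) (_ ∷ q) h (there x∈p) = there (++-⊆⁻ˡ p q (drop-∷-⊆ h) x∈p)

++-⊆⁻ʳ : ∀ {m n} (p q : Subset m) {p′ q′ : Subset n} → p ++ p′ ⊆ q ++ q′ → p′ ⊆ q′
++-⊆⁻ʳ []      []      h = h
++-⊆⁻ʳ (_ ∷ p) (_ ∷ q) h = ++-⊆⁻ʳ p q (drop-∷-⊆ h)

++-⊆⁺ : ∀ {m n} (p q : Subset m) {p′ q′ : Subset n} → p ⊆ q → p′ ⊆ q′ → p ++ p′ ⊆ q ++ q′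
++-⊆⁺ []      []      h h′ x∈ = h′ x∈
++-⊆⁺ (_ ∷ p) (_ ∷ q) h h′ here with here ← h here = here
++-⊆⁺ (_ ∷ p) (_ ∷ q) h h′ (there x∈) = there (++-⊆⁺ p q (drop-∷-⊆ h) h′ x∈)

-- Binary trees

-- A set of leaves of the complete binary tree of depth n.
data Tree : ℕ → Set where
  leaf : Bool → Tree 0
  fork : ∀ {n} → Tree n → Tree n → Tree (suc n)

size : ∀ {n} → Tree n → ℕ
size (leaf false) = 0
size (leaf true)  = 1
size (fork l r)   = size l + size r

data _⊑_ : ∀ {n} → Tree n → Tree n → Set where
  absent  : ∀ {b} → leaf false ⊑ leaf b
  present : leaf true ⊑ leaf true
  fork    : ∀ {n} {l l′ r r′ : Tree n} → l ⊑ l′ → r ⊑ r′ → fork l r ⊑ fork l′ r′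

empty : ∀ n → Tree n
empty zero    = leaf false
empty (suc n) = fork (empty n) (empty n)

empty⊑ : ∀ {n} (t : Tree n) → empty n ⊑ t
empty⊑ (leaf _)   = absent
empty⊑ (fork l r) = fork (empty⊑ l) (empty⊑ r)

size-empty : ∀ n → size (empty n) ≡ 0
size-empty zero    = refl
size-empty (suc n) = cong₂ _+_ (size-empty n) (size-empty n)

-- Powers of two by doubling: a set of leaves then splits at the root by `take` and `drop`, without
-- the `+ 0` that `2 ^ suc n` unfolds to.
pow : ℕ → ℕ
pow zero    = 1
pow (suc n) = pow n + pow n

pow≡2^ : ∀ n → pow n ≡ 2 ^ n
pow≡2^ zero    = refl
pow≡2^ (suc n) = cong₂ _+_ (pow≡2^ n) (trans (pow≡2^ n) (sym (+-identityʳ (2 ^ n))))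

toTree : ∀ n → Subset (pow n) → Tree n
toTree zero    (b ∷ []) = leaf b
toTree (suc n) p        = fork (toTree n (take (pow n) p)) (toTree n (drop (pow n) p))

fromTree : ∀ {n} → Tree n → Subset (pow n)
fromTree (leaf b)   = b ∷ []
fromTree (fork l r) = fromTree l ++ fromTree r

toTree∘fromTree : ∀ {n} (t : Tree n) → toTree n (fromTree t) ≡ t
toTree∘fromTree (leaf b) = refl
toTree∘fromTree {suc n} (fork l r)
  with take≡ , drop≡ ← ++-injective _ (fromTree l) (take++drop≡id (pow n) (fromTree l ++ fromTree r))
  = cong₂ fork (trans (cong (toTree n) take≡) (toTree∘fromTree l))
               (trans (cong (toTree n) drop≡) (toTree∘fromTree r))

fromTree∘toTree : ∀ n (p : Subset (pow n)) → fromTree (toTree n p) ≡ p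
fromTree∘toTree zero    (b ∷ []) = refl
fromTree∘toTree (suc n) p        =
  trans (cong₂ _++_ (fromTree∘toTree n (take (pow n) p)) (fromTree∘toTree n (drop (pow n) p)))
        (take++drop≡id (pow n) p)

∣fromTree∣ : ∀ {n} (t : Tree n) → ∣ fromTree t ∣ ≡ size t
∣fromTree∣ (leaf false) = refl
∣fromTree∣ (leaf true)  = refl
∣fromTree∣ (fork l r)   =
  trans (∣p++q∣≡∣p∣+∣q∣ (fromTree l) (fromTree r)) (cong₂ _+_ (∣fromTree∣ l) (∣fromTree∣ r))

size-toTree : ∀ n (p : Subset (pow n)) → size (toTree n p) ≡ ∣ p ∣
size-toTree n p = trans (sym (∣fromTree∣ (toTree n p))) (cong ∣_∣ (fromTree∘toTree n p))

fromTree-mono : ∀ {n} {s t : Tree n} → s ⊑ t → fromTree s ⊆ fromTree t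
fromTree-mono absent             = out⊆ id
fromTree-mono present            = id
fromTree-mono (fork {l = l} {l′} s⊑t s⊑t′) =
  ++-⊆⁺ (fromTree l) (fromTree l′) (fromTree-mono s⊑t) (fromTree-mono s⊑t′)

fromTree-⊆⁻ : ∀ {n} (s t : Tree n) → fromTree s ⊆ fromTree t → s ⊑ t
fromTree-⊆⁻ (leaf false) (leaf _)     h = absent
fromTree-⊆⁻ (leaf true)  (leaf true)  h = present
fromTree-⊆⁻ (leaf true)  (leaf false) h with () ← h here
fromTree-⊆⁻ (fork l r)   (fork l′ r′) h =
  fork (fromTree-⊆⁻ l l′ (++-⊆⁻ˡ (fromTree l) (fromTree l′) h))
       (fromTree-⊆⁻ r r′ (++-⊆⁻ʳ (fromTree l) (fromTree l′) h))

toTree-mono : ∀ n {p q : Subset (pow n)} → p ⊆ q → toTree n p ⊑ toTree n q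
toTree-mono n {p} {q} p⊆q = fromTree-⊆⁻ _ _
  (subst₂ _⊆_ (sym (fromTree∘toTree n p)) (sym (fromTree∘toTree n q)) p⊆q)

fromTree⊆ : ∀ n {t} {p : Subset (pow n)} → t ⊑ toTree n p → fromTree t ⊆ p
fromTree⊆ n {t} {p} t⊑p = subst (fromTree t ⊆_) (fromTree∘toTree n p) (fromTree-mono t⊑p)

-- Shapes as topological minors

data Shape : Set where
  tip  : Shape
  join : Shape → Shape → Shape

tips : Shape → ℕ
tips tip        = 1
tips (join s t) = tips s + tips t

height : Shape → ℕ
height tip        = 0
height (join s t) = suc (height s ⊔ height t)

-- The plane binary tree σ is a topological minor of the tree spanned by the
-- leaves.
data Has : ∀ {n} → Shape → Tree n → Set where
  tip  : Has tip (leaf true)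
  inˡ  : ∀ {n σ} {l r : Tree n} → Has σ l → Has σ (fork l r)
  inʳ  : ∀ {n σ} {l r : Tree n} → Has σ r → Has σ (fork l r)
  join : ∀ {n σ τ} {l r : Tree n} → Has σ l → Has τ r → Has (join σ τ) (fork l r)

has? : ∀ {n} σ (t : Tree n) → Dec (Has σ t)
has? tip        (leaf true)  = yes tip
has? tip        (leaf false) = no λ ()
has? (join _ _) (leaf _)     = no λ ()
has? tip        (fork l r)   =
  map′ [ inˡ , inʳ ]′ (λ { (inˡ h) → inj₁ h ; (inʳ h) → inj₂ h }) (has? tip l ⊎-dec has? tip r)
has? (join σ τ) (fork l r)   =
  map′ [ inˡ , [ inʳ , (λ { (h , h′) → join h h′ }) ]′ ]′
       (λ { (inˡ h) → inj₁ h ; (inʳ h) → inj₂ (inj₁ h) ; (join h h′) → inj₂ (inj₂ (h , h′)) })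
       (has? (join σ τ) l ⊎-dec has? (join σ τ) r ⊎-dec has? σ l ×-dec has? τ r)

has-tip : ∀ {n σ} {t : Tree n} → Has σ t → Has tip t
has-tip tip        = tip
has-tip (inˡ h)    = inˡ (has-tip h)
has-tip (inʳ h)    = inʳ (has-tip h)
has-tip (join h _) = inˡ (has-tip h)

Has-mono : ∀ {n σ} {s t : Tree n} → s ⊑ t → Has σ s → Has σ t
Has-mono present      tip         = tip
Has-mono (fork l⊑ _)  (inˡ h)     = inˡ (Has-mono l⊑ h)
Has-mono (fork _ r⊑)  (inʳ h)     = inʳ (Has-mono r⊑ h)
Has-mono (fork l⊑ r⊑) (join h h′) = join (Has-mono l⊑ h) (Has-mono r⊑ h′)

Has-witness : ∀ {n σ} {t : Tree n} → Has σ t → ∃ λ s → s ⊑ t × size s ≡ tips σ × Has σ s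
Has-witness tip = leaf true , present , refl , tip
Has-witness {suc n} (inˡ {r = r} h) with s , s⊑ , ∣s∣ , h′ ← Has-witness h =
  fork s (empty n) , fork s⊑ (empty⊑ r) , trans (cong₂ _+_ ∣s∣ (size-empty n)) (+-identityʳ _) , inˡ h′
Has-witness {suc n} (inʳ {l = l} h) with s , s⊑ , ∣s∣ , h′ ← Has-witness h =
  fork (empty n) s , fork (empty⊑ l) s⊑ , cong₂ _+_ (size-empty n) ∣s∣ , inʳ h′
Has-witness (join h₁ h₂)
  with s₁ , s₁⊑ , ∣s₁∣ , h₁′ ← Has-witness h₁ | s₂ , s₂⊑ , ∣s₂∣ , h₂′ ← Has-witness h₂ =
  fork s₁ s₂ , fork s₁⊑ s₂⊑ , cong₂ _+_ ∣s₁∣ ∣s₂∣ , join h₁′ h₂′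

tips≤size : ∀ {n σ} {t : Tree n} → Has σ t → tips σ ≤ size t
tips≤size tip                 = ≤-refl
tips≤size (inˡ {l = l} h)     = ≤-trans (tips≤size h) (m≤m+n (size l) _)
tips≤size (inʳ {r = r} h)     = ≤-trans (tips≤size h) (m≤n+m (size r) _)
tips≤size (join h h′)         = +-mono-≤ (tips≤size h) (tips≤size h′)

full : ℕ → Shape
full zero    = tip
full (suc d) = join (full d) (full d)

tips-full : ∀ d → tips (full d) ≡ 2 ^ d
tips-full zero    = refl
tips-full (suc d) = cong₂ _+_ (tips-full d) (trans (tips-full d) (sym (+-identityʳ (2 ^ d))))

height-full : ∀ d → height (full d) ≡ d
height-full zero    = refl
height-full (suc d) = cong suc (trans (⊔-idem _) (height-full d))

-- The first branching of the complete tree serves as the root of `join σ τ`, and its two halves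
-- host `σ` and `τ`. Hence a large complete tree contains all three shapes of the step-up.
full-universal : ∀ {n d} {t : Tree n} σ → height σ ≤ d → Has (full d) t → Has σ t
full-universal tip _ h = has-tip h
full-universal {d = suc d} (join σ τ) σ≤ (inˡ h) = inˡ (full-universal (join σ τ) σ≤ h)
full-universal {d = suc d} (join σ τ) σ≤ (inʳ h) = inʳ (full-universal (join σ τ) σ≤ h)
full-universal {d = suc d} (join σ τ) (s≤s σ≤) (join h h′) =
  join (full-universal σ (≤-trans (m≤m⊔n (height σ) (height τ)) σ≤) h)
       (full-universal τ (≤-trans (m≤n⊔m (height σ) (height τ)) σ≤) h′)

-- Some root-to-leaf path of the tree branches at every level in D.
data Path : ∀ {n} → Tree n → Subset n → Set where
  end     : Path (leaf true) []
  left    : ∀ {n D} {l r : Tree n} → Path l D → Path (fork l r) (outside ∷ D)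
  right   : ∀ {n D} {l r : Tree n} → Path r D → Path (fork l r) (outside ∷ D)
  branchˡ : ∀ {n D} {l r : Tree n} → Path l D → Has tip r → Path (fork l r) (inside ∷ D)
  branchʳ : ∀ {n D} {l r : Tree n} → Has tip l → Path r D → Path (fork l r) (inside ∷ D)

Path⇒tip : ∀ {n D} {t : Tree n} → Path t D → Has tip t
Path⇒tip end           = tip
Path⇒tip (left p)      = inˡ (Path⇒tip p)
Path⇒tip (right p)     = inʳ (Path⇒tip p)
Path⇒tip (branchˡ p _) = inˡ (Path⇒tip p)
Path⇒tip (branchʳ _ p) = inʳ (Path⇒tip p)

Path-mono : ∀ {n D} {s t : Tree n} → s ⊑ t → Path s D → Path t D
Path-mono present      end           = end
Path-mono (fork l⊑ _)  (left p)      = left (Path-mono l⊑ p)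
Path-mono (fork _ r⊑)  (right p)     = right (Path-mono r⊑ p)
Path-mono (fork l⊑ r⊑) (branchˡ p h) = branchˡ (Path-mono l⊑ p) (Has-mono r⊑ h)
Path-mono (fork l⊑ r⊑) (branchʳ h p) = branchʳ (Has-mono l⊑ h) (Path-mono r⊑ p)

Path-restrict : ∀ {n} {t : Tree n} D′ {D} → D′ ⊆ D → Path t D → Path t D′
Path-restrict []             _ end           = end
Path-restrict (inside ∷ D′)  h (left p)      with () ← h here
Path-restrict (inside ∷ D′)  h (right p)     with () ← h here
Path-restrict (inside ∷ D′)  h (branchˡ p b) = branchˡ (Path-restrict D′ (drop-∷-⊆ h) p) b
Path-restrict (inside ∷ D′)  h (branchʳ b p) = branchʳ b (Path-restrict D′ (drop-∷-⊆ h) p)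
Path-restrict (outside ∷ D′) h (left p)      = left (Path-restrict D′ (drop-∷-⊆ h) p)
Path-restrict (outside ∷ D′) h (right p)     = right (Path-restrict D′ (drop-∷-⊆ h) p)
Path-restrict (outside ∷ D′) h (branchˡ p _) = left (Path-restrict D′ (drop-∷-⊆ h) p)
Path-restrict (outside ∷ D′) h (branchʳ _ p) = right (Path-restrict D′ (drop-∷-⊆ h) p)

-- Keep the end of the path and, for each level in `D`, one leaf that branches off there.
Path-witness : ∀ {n D} {t : Tree n} → Path t D → ∃ λ s → s ⊑ t × size s ≡ suc ∣ D ∣ × Path s D
Path-witness end = leaf true , present , refl , end
Path-witness {suc n} (left {r = r} p) with s , s⊑ , ∣s∣ , p′ ← Path-witness p =
  fork s (empty n) , fork s⊑ (empty⊑ r) , trans (cong₂ _+_ ∣s∣ (size-empty n)) (+-identityʳ _) , left p′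
Path-witness {suc n} (right {l = l} p) with s , s⊑ , ∣s∣ , p′ ← Path-witness p =
  fork (empty n) s , fork (empty⊑ l) s⊑ , cong₂ _+_ (size-empty n) ∣s∣ , right p′
Path-witness (branchˡ p h)
  with s , s⊑ , ∣s∣ , p′ ← Path-witness p | u , u⊑ , ∣u∣ , h′ ← Has-witness h =
  fork s u , fork s⊑ u⊑ , trans (cong₂ _+_ ∣s∣ ∣u∣) (+-comm _ 1) , branchˡ p′ h′
Path-witness (branchʳ h p)
  with s , s⊑ , ∣s∣ , p′ ← Path-witness p | u , u⊑ , ∣u∣ , h′ ← Has-witness h =
  fork u s , fork u⊑ s⊑ , cong₂ _+_ ∣u∣ ∣s∣ , branchʳ h′ p′

positive : ℕ → Bool
positive zero    = false
positive (suc _) = true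

-- The levels at which some vertex of the tree has leaves of the set on both sides.
levels : ∀ {n} → Tree n → Subset n
levels (leaf _)   = []
levels (fork l r) = (positive (size l) ∧ positive (size r)) ∷ (levels l ∪ levels r)

-- A binary tree with `s ≥ 1` leaves has `s - 1` branching vertices, and each accounts for one
-- level.
∣levels∣ : ∀ {n} (t : Tree n) → ∣ levels t ∣ ≤ pred (size t)
∣levels∣ (leaf false) = z≤n
∣levels∣ (leaf true)  = z≤n
∣levels∣ (fork l r) with size l | size r | ∣levels∣ l | ∣levels∣ r
... | zero  | zero  | hl | hr = ≤-trans (∣∪∣≤ (levels l) (levels r)) (+-mono-≤ hl hr)
... | zero  | suc _ | hl | hr = ≤-trans (∣∪∣≤ (levels l) (levels r)) (+-mono-≤ hl hr)
... | suc a | zero  | hl | hr = ≤-trans (∣∪∣≤ (levels l) (levels r)) (+-mono-≤ hl hr)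
... | suc a | suc b | hl | hr = ≤-trans
  (s≤s (≤-trans (∣∪∣≤ (levels l) (levels r)) (+-mono-≤ hl hr)))
  (≤-reflexive (sym (+-suc a b)))

∈-head : ∀ {n b} {p : Subset n} → b ≡ inside → zero ∈ˢ (b ∷ p)
∈-head refl = here

positive-size : ∀ {n} {t : Tree n} → Has tip t → positive (size t) ≡ inside
positive-size {t = t} h with size t | tips≤size h
... | suc _ | _ = refl

-- Consequently a family that misses `levels t` misses the branching levels of every path of `t` at
-- once.
Path⊆levels : ∀ {n D} {t : Tree n} → Path t D → D ⊆ levels t
Path⊆levels (left {r = r} p)          (there x) = there (p⊆p∪q (levels r) (Path⊆levels p x))
Path⊆levels (right {l = l} {r} p)     (there x) = there (q⊆p∪q (levels l) (levels r) (Path⊆levels p x))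
Path⊆levels (branchˡ {l = l} {r} p h) here      =
  ∈-head (cong₂ _∧_ (positive-size (Path⇒tip p)) (positive-size h))
Path⊆levels (branchˡ {r = r} p h)     (there x) = there (p⊆p∪q (levels r) (Path⊆levels p x))
Path⊆levels (branchʳ h p)             here      =
  ∈-head (cong₂ _∧_ (positive-size h) (positive-size (Path⇒tip p)))
Path⊆levels (branchʳ {l = l} {r} h p) (there x) = there (q⊆p∪q (levels l) (levels r) (Path⊆levels p x))

size≡suc⇒tip : ∀ {n a} (t : Tree n) → size t ≡ suc a → Has tip t
size≡suc⇒tip (leaf true) _  = tip
size≡suc⇒tip (fork l r)  eq with size l in ∣l∣
... | suc _ = inˡ (size≡suc⇒tip l ∣l∣)
... | zero  = inʳ (size≡suc⇒tip r eq)

tip⇒path : ∀ {n} {t : Tree n} → Has tip t → ∃ λ D → Path t D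
tip⇒path tip     = _ , end
tip⇒path (inˡ h) = _ , left (proj₂ (tip⇒path h))
tip⇒path (inʳ h) = _ , right (proj₂ (tip⇒path h))

-- Pigeonhole on Strahler numbers: a tree of height at most h without full (r + 1)
-- has at most (h + 1) ^ r tips.
path-or-full : ∀ {n} h r (t : Tree n) → suc h ^ r < size t →
               (∃ λ D → Path t D × suc h ≤ ∣ D ∣) ⊎ Has (full (suc r)) t
path-or-full h r (leaf true)  big = contradiction big (≤⇒≯ (m^n>0 (suc h) r))
path-or-full h r (fork l r′) big with size l in ∣l∣ | size r′ in ∣r∣
... | zero  | _     with path-or-full h r r′ (subst (suc h ^ r <_) (sym ∣r∣) big)
...   | inj₁ (D , p , h≤) = inj₁ (_ , right p , h≤)
...   | inj₂ f            = inj₂ (inʳ f)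
path-or-full h r (fork l r′) big | suc a | zero
  with path-or-full h r l (subst (suc h ^ r <_) (trans (+-identityʳ (suc a)) (sym ∣l∣)) big)
... | inj₁ (D , p , h≤) = inj₁ (_ , left p , h≤)
... | inj₂ f            = inj₂ (inˡ f)
path-or-full h zero    (fork l r′) big | suc a | suc b =
  inj₂ (join (size≡suc⇒tip l ∣l∣) (size≡suc⇒tip r′ ∣r∣))
path-or-full zero (suc r) (fork l r′) big | suc a | suc b =
  inj₁ (_ , branchˡ (proj₂ (tip⇒path (size≡suc⇒tip l ∣l∣))) (size≡suc⇒tip r′ ∣r∣) , s≤s z≤n)
-- The root branches, so the subtrees need one branching fewer. Each is tested against the bound for
-- the same complete tree and against the bound for one of depth one less, two of which join at the
-- root.
path-or-full (suc h) (suc r) (fork l r′) big | suc a | suc b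
  with path? l (suc r) | path? r′ (suc r) | path? l r | path? r′ r
  where
  path? : ∀ {n} (t : Tree n) q → size t ≤ suc h ^ q ⊎
          ((∃ λ D → Path t D × suc h ≤ ∣ D ∣) ⊎ Has (full (suc q)) t)
  path? t q with suc h ^ q <? size t
  ... | yes big = inj₂ (path-or-full h q t big)
  ... | no ≤    = inj₁ (≮⇒≥ ≤)
... | inj₂ (inj₂ f) | _ | _ | _ = inj₂ (inˡ f)
... | inj₂ (inj₁ (D , p , h≤)) | _ | _ | _ =
  inj₁ (_ , branchˡ p (size≡suc⇒tip r′ ∣r∣) , s≤s h≤)
... | inj₁ _ | inj₂ (inj₂ f) | _ | _ = inj₂ (inʳ f)
... | inj₁ _ | inj₂ (inj₁ (D , p , h≤)) | _ | _ =
  inj₁ (_ , branchʳ (size≡suc⇒tip l ∣l∣) p , s≤s h≤)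
... | inj₁ _ | inj₁ _ | inj₂ (inj₁ (D , p , h≤)) | _ =
  inj₁ (_ , branchˡ p (size≡suc⇒tip r′ ∣r∣) , s≤s h≤)
... | inj₁ _ | inj₁ _ | inj₂ (inj₂ _) | inj₂ (inj₁ (D , p , h≤)) =
  inj₁ (_ , branchʳ (size≡suc⇒tip l ∣l∣) p , s≤s h≤)
... | inj₁ _ | inj₁ _ | inj₂ (inj₂ f) | inj₂ (inj₂ f′) = inj₂ (join f f′)
-- If no alternative arises, one side has at most `(h + 1) ^ r` tips and the other at most
-- `(h + 1) ^ (r + 1)`, together at most `(h + 2) ^ (r + 1)`.
... | inj₁ _ | inj₁ r≤ | inj₁ l≤ | _ = contradiction big (≤⇒≯ (begin
    suc a + suc b                           ≡⟨ cong₂ _+_ ∣l∣ ∣r∣ ⟨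
    size l + size r′                        ≤⟨ +-mono-≤ l≤ r≤ ⟩
    suc h ^ r + suc h * suc h ^ r           ≡⟨⟩
    suc (suc h) * suc h ^ r                 ≤⟨ *-monoʳ-≤ (suc (suc h)) (^-monoˡ-≤ r (n≤1+n (suc h))) ⟩
    suc (suc h) * suc (suc h) ^ r           ∎))
  where open ≤-Reasoning
... | inj₁ l≤ | inj₁ _ | inj₂ _ | inj₁ r≤ = contradiction big (≤⇒≯ (begin
    suc a + suc b                           ≡⟨ cong₂ _+_ ∣l∣ ∣r∣ ⟨
    size l + size r′                        ≤⟨ +-mono-≤ l≤ r≤ ⟩
    suc h * suc h ^ r + suc h ^ r           ≡⟨ +-comm (suc h * suc h ^ r) (suc h ^ r) ⟩
    suc (suc h) * suc h ^ r                 ≤⟨ *-monoʳ-≤ (suc (suc h)) (^-monoˡ-≤ r (n≤1+n (suc h))) ⟩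
    suc (suc h) * suc (suc h) ^ r           ∎))
  where open ≤-Reasoning

-- Overlaps of combs and complete trees

combˡ combʳ : ℕ → Shape
combˡ zero    = tip
combˡ (suc a) = join (combˡ a) tip
combʳ zero    = tip
combʳ (suc a) = join tip (combʳ a)

tips-combˡ : ∀ a → tips (combˡ a) ≡ suc a
tips-combˡ zero    = refl
tips-combˡ (suc a) = trans (cong (_+ 1) (tips-combˡ a)) (+-comm (suc a) 1)

tips-combʳ : ∀ a → tips (combʳ a) ≡ suc a
tips-combʳ zero    = refl
tips-combʳ (suc a) = cong suc (tips-combʳ a)

height-combˡ : ∀ a → height (combˡ a) ≡ a
height-combˡ zero    = refl
height-combˡ (suc a) = cong suc (trans (⊔-identityʳ _) (height-combˡ a))

height-combʳ : ∀ a → height (combʳ a) ≡ a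
height-combʳ zero    = refl
height-combʳ (suc a) = cong suc (height-combʳ a)

combˡ-size : ∀ {n a} {t : Tree n} → Has (combˡ a) t → suc a ≤ size t
combˡ-size {a = a} h = subst (_≤ _) (tips-combˡ a) (tips≤size h)

combʳ-size : ∀ {n a} {t : Tree n} → Has (combʳ a) t → suc a ≤ size t
combʳ-size {a = a} h = subst (_≤ _) (tips-combʳ a) (tips≤size h)

full-size : ∀ {n} d {t : Tree n} → Has (full d) t → 2 ^ d ≤ size t
full-size d h = subst (_≤ _) (tips-full d) (tips≤size h)

-- The position of a comb in a fork, in the form that the counts use: `e` is 1 if the comb branches
-- at the root, with one tooth in the other subtree, and 0 if it stays on the side of its spine.
data Combˡ {n} (a : ℕ) (l r : Tree n) : Set where
  inˡ : ∀ e a₀ → a ≡ e + a₀ → e ≤ 1 → e ≤ size r → Has (combˡ a₀) l → Combˡ a l r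
  inʳ : Has (combˡ a) r → Combˡ a l r

data Combʳ {n} (b : ℕ) (l r : Tree n) : Set where
  inˡ : Has (combʳ b) l → Combʳ b l r
  inʳ : ∀ e b₀ → b ≡ e + b₀ → e ≤ 1 → e ≤ size l → Has (combʳ b₀) r → Combʳ b l r

data Full {n} (d : ℕ) (l r : Tree n) : Set where
  inˡ  : Has (full d) l → Full d l r
  inʳ  : Has (full d) r → Full d l r
  join : ∀ d₀ → d ≡ suc d₀ → Has (full d₀) l → Has (full d₀) r → Full d l r

splitˡ : ∀ {n} a {l r : Tree n} → Has (combˡ a) (fork l r) → Combˡ a l r
splitˡ zero    (inˡ h)     = inˡ 0 0 refl z≤n z≤n h
splitˡ (suc a) (inˡ h)     = inˡ 0 (suc a) refl z≤n z≤n h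
splitˡ zero    (inʳ h)     = inʳ h
splitˡ (suc a) (inʳ h)     = inʳ h
splitˡ (suc a) (join h h′) = inˡ 1 a refl ≤-refl (tips≤size h′) h

splitʳ : ∀ {n} b {l r : Tree n} → Has (combʳ b) (fork l r) → Combʳ b l r
splitʳ zero    (inʳ h)     = inʳ 0 0 refl z≤n z≤n h
splitʳ (suc b) (inʳ h)     = inʳ 0 (suc b) refl z≤n z≤n h
splitʳ zero    (inˡ h)     = inˡ h
splitʳ (suc b) (inˡ h)     = inˡ h
splitʳ (suc b) (join h h′) = inʳ 1 b refl ≤-refl (tips≤size h) h′

splitFull : ∀ {n} d {l r : Tree n} → Has (full d) (fork l r) → Full d l r
splitFull zero    (inˡ h)     = inˡ h
splitFull (suc d) (inˡ h)     = inˡ h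
splitFull zero    (inʳ h)     = inʳ h
splitFull (suc d) (inʳ h)     = inʳ h
splitFull (suc d) (join h h′) = join d refl h h′

-- As long as both combs continue into the same subtree, only one of them can branch at the root.
-- Both can branch only where their spines part, so of the `a + 1` and `b + 1` tips at most two are
-- counted twice.
combs≤size : ∀ {n} a b (t : Tree n) → Has (combˡ a) t → Has (combʳ b) t → a + b ≤ size t
combs≤size zero zero (leaf _) _ _ = z≤n
combs≤size a b (fork l r) A B with splitˡ a A | splitʳ b B
... | inˡ e a₀ refl _ e≤r A′ | inˡ B′ =
  ≤-by 0 (+-mono-≤ (combs≤size a₀ b l A′ B′) e≤r) (eq e a₀ b (size l) (size r))
  where
  eq : ∀ e a b x y → e + a + b + (x + y) + 0 ≡ x + y + (a + b + e)
  eq = solve-∀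
... | inˡ e a₀ refl e≤1 _ A′ | inʳ e′ b₀ refl e′≤1 _ B′ =
  ≤-by 0 (+-mono-≤ (+-mono-≤ (combˡ-size A′) (combʳ-size B′)) (+-mono-≤ e≤1 e′≤1))
    (eq e e′ a₀ b₀ (size l) (size r))
  where
  eq : ∀ e e′ a b x y → e + a + (e′ + b) + (x + y + (1 + 1)) + 0 ≡ x + y + (suc a + suc b + (e + e′))
  eq = solve-∀
... | inʳ A′ | inˡ B′ =
  ≤-by 2 (+-mono-≤ (combˡ-size A′) (combʳ-size B′)) (eq a b (size l) (size r))
  where
  eq : ∀ a b x y → a + b + (y + x) + 2 ≡ x + y + (suc a + suc b)
  eq = solve-∀
... | inʳ A′ | inʳ e b₀ refl _ e≤l B′ =
  ≤-by 0 (+-mono-≤ (combs≤size a b₀ r A′ B′) e≤l) (eq e a b₀ (size l) (size r))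
  where
  eq : ∀ e a b x y → a + (e + b) + (y + x) + 0 ≡ x + y + (a + b + e)
  eq = solve-∀

-- When both shapes branch at a vertex, the spine enters one half of the complete tree and only a
-- single tooth can fall into the other half. So each of the `d` levels of the complete tree costs
-- at most one shared tip, and the end of the comb one more.
combˡ-full≤size : ∀ {n} a d (t : Tree n) → Has (combˡ a) t → Has (full d) t → a + 2 ^ d ≤ size t + d
combˡ-full≤size zero zero (leaf true) _ _ = s≤s z≤n
combˡ-full≤size a d (fork l r) A F with splitˡ a A | splitFull d F
... | inˡ e a₀ refl _ e≤r A′ | inˡ F′ =
  ≤-by 0 (+-mono-≤ (combˡ-full≤size a₀ d l A′ F′) e≤r) (eq e a₀ d (size l) (size r) (2 ^ d))
  where
  eq : ∀ e a d x y P → e + a + P + (x + d + y) + 0 ≡ x + y + d + (a + P + e)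
  eq = solve-∀
... | inˡ e a₀ refl e≤1 _ A′ | inʳ F′ =
  ≤-by d (+-mono-≤ (+-mono-≤ (combˡ-size A′) (full-size d F′)) e≤1) (eq e a₀ d (size l) (size r) (2 ^ d))
  where
  eq : ∀ e a d x y P → e + a + P + (x + y + 1) + d ≡ x + y + d + (suc a + P + e)
  eq = solve-∀
... | inˡ e a₀ refl e≤1 _ A′ | join d₀ refl F₁ F₂ =
  ≤-by 0 (+-mono-≤ (+-mono-≤ (combˡ-full≤size a₀ d₀ l A′ F₁) (full-size d₀ F₂)) e≤1)
    (eq e a₀ d₀ (size l) (size r) (2 ^ d₀))
  where
  eq : ∀ e a d x y P → e + a + (P + (P + 0)) + (x + d + y + 1) + 0 ≡ x + y + suc d + (a + P + P + e)
  eq = solve-∀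
... | inʳ A′ | inˡ F′ =
  ≤-by (1 + d) (+-mono-≤ (combˡ-size A′) (full-size d F′)) (eq a d (size l) (size r) (2 ^ d))
  where
  eq : ∀ a d x y P → a + P + (y + x) + (1 + d) ≡ x + y + d + (suc a + P)
  eq = solve-∀
... | inʳ A′ | inʳ F′ =
  ≤-by (size l) (combˡ-full≤size a d r A′ F′) (eq a d (size l) (size r) (2 ^ d))
  where
  eq : ∀ a d x y P → a + P + (y + d) + x ≡ x + y + d + (a + P)
  eq = solve-∀
... | inʳ A′ | join d₀ refl F₁ F₂ =
  ≤-by 1 (+-mono-≤ (combˡ-full≤size a d₀ r A′ F₂) (full-size d₀ F₁)) (eq a d₀ (size l) (size r) (2 ^ d₀))
  where
  eq : ∀ a d x y P → a + (P + (P + 0)) + (y + d + x) + 1 ≡ x + y + suc d + (a + P + P)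
  eq = solve-∀

-- Reflection exchanges the two kinds of comb and preserves complete trees, so that the count for
-- one comb yields the count for the other.
mirror : ∀ {n} → Tree n → Tree n
mirror (leaf b)   = leaf b
mirror (fork l r) = fork (mirror r) (mirror l)

size-mirror : ∀ {n} (t : Tree n) → size (mirror t) ≡ size t
size-mirror (leaf _)   = refl
size-mirror (fork l r) = trans (cong₂ _+_ (size-mirror r) (size-mirror l)) (+-comm (size r) (size l))

mirrorShape : Shape → Shape
mirrorShape tip        = tip
mirrorShape (join σ τ) = join (mirrorShape τ) (mirrorShape σ)

Has-mirror : ∀ {n σ} {t : Tree n} → Has σ t → Has (mirrorShape σ) (mirror t)
Has-mirror tip         = tip
Has-mirror (inˡ h)     = inʳ (Has-mirror h)
Has-mirror (inʳ h)     = inˡ (Has-mirror h)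
Has-mirror (join h h′) = join (Has-mirror h′) (Has-mirror h)

mirror-combʳ : ∀ a → mirrorShape (combʳ a) ≡ combˡ a
mirror-combʳ zero    = refl
mirror-combʳ (suc a) = cong (λ σ → join σ tip) (mirror-combʳ a)

mirror-full : ∀ d → mirrorShape (full d) ≡ full d
mirror-full zero    = refl
mirror-full (suc d) = cong₂ join (mirror-full d) (mirror-full d)

combʳ-full≤size : ∀ {n} b d (t : Tree n) → Has (combʳ b) t → Has (full d) t → b + 2 ^ d ≤ size t + d
combʳ-full≤size b d t B F = subst (λ s → b + 2 ^ d ≤ s + d) (size-mirror t)
  (combˡ-full≤size b d (mirror t)
    (subst (λ σ → Has σ (mirror t)) (mirror-combʳ b) (Has-mirror B))
    (subst (λ σ → Has σ (mirror t)) (mirror-full d) (Has-mirror F)))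

-- The three shapes pairwise overlap in few tips, so a tree containing all three
-- has almost as many tips as the three together.
combs-full≤size : ∀ {n} a b d (t : Tree n) → Has (combˡ a) t → Has (combʳ b) t → Has (full d) t →
                  a + b + 2 ^ d ≤ size t + (d + d + 1)
combs-full≤size zero zero zero (leaf true) _ _ _ = s≤s z≤n
combs-full≤size a b d (fork l r) A B F with splitˡ a A | splitʳ b B | splitFull d F
... | inˡ e a₀ refl _ e≤r A′ | inˡ B′ | inˡ F′ =
  ≤-by 0 (+-mono-≤ (combs-full≤size a₀ b d l A′ B′ F′) e≤r) (eq e a₀ b d (size l) (size r) (2 ^ d))
  where
  eq : ∀ e a b d x y P → e + a + b + P + (x + (d + d + 1) + y) + 0 ≡ x + y + (d + d + 1) + (a + b + P + e)
  eq = solve-∀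
-- For `d = 0` there is nothing to spare: the tooth in the right subtree may be the only tip of the
-- complete tree. Hence the summand `1` in the bound.
... | inˡ e a₀ refl e≤1 _ A′ | inˡ B′ | inʳ F′ =
  ≤-by (d + d) (+-mono-≤ (+-mono-≤ (combs≤size a₀ b l A′ B′) (full-size d F′)) e≤1)
    (eq e a₀ b d (size l) (size r) (2 ^ d))
  where
  eq : ∀ e a b d x y P → e + a + b + P + (x + y + 1) + (d + d) ≡ x + y + (d + d + 1) + (a + b + P + e)
  eq = solve-∀
... | inˡ e a₀ refl e≤1 _ A′ | inˡ B′ | join d₀ refl F₁ F₂ =
  ≤-by 1 (+-mono-≤ (+-mono-≤ (combs-full≤size a₀ b d₀ l A′ B′ F₁) (full-size d₀ F₂)) e≤1)
    (eq e a₀ b d₀ (size l) (size r) (2 ^ d₀))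
  where
  eq : ∀ e a b d x y P → e + a + b + (P + (P + 0)) + (x + (d + d + 1) + y + 1) + 1
                         ≡ x + y + (suc d + suc d + 1) + (a + b + P + P + e)
  eq = solve-∀
... | inˡ e a₀ refl e≤1 _ A′ | inʳ e′ b₀ refl e′≤1 _ B′ | inˡ F′ =
  ≤-by d (+-mono-≤ (+-mono-≤ (combˡ-full≤size a₀ d l A′ F′) (combʳ-size B′)) (+-mono-≤ e≤1 e′≤1))
    (eq e e′ a₀ b₀ d (size l) (size r) (2 ^ d))
  where
  eq : ∀ e e′ a b d x y P → e + a + (e′ + b) + P + (x + d + y + (1 + 1)) + d
                            ≡ x + y + (d + d + 1) + (a + P + suc b + (e + e′))
  eq = solve-∀
... | inˡ e a₀ refl e≤1 _ A′ | inʳ e′ b₀ refl e′≤1 _ B′ | inʳ F′ =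
  ≤-by d (+-mono-≤ (+-mono-≤ (combʳ-full≤size b₀ d r B′ F′) (combˡ-size A′)) (+-mono-≤ e≤1 e′≤1))
    (eq e e′ a₀ b₀ d (size l) (size r) (2 ^ d))
  where
  eq : ∀ e e′ a b d x y P → e + a + (e′ + b) + P + (y + d + x + (1 + 1)) + d
                            ≡ x + y + (d + d + 1) + (b + P + suc a + (e + e′))
  eq = solve-∀
... | inˡ e a₀ refl e≤1 _ A′ | inʳ e′ b₀ refl e′≤1 _ B′ | join d₀ refl F₁ F₂ =
  ≤-by 1 (+-mono-≤ (+-mono-≤ (combˡ-full≤size a₀ d₀ l A′ F₁) (combʳ-full≤size b₀ d₀ r B′ F₂)) (+-mono-≤ e≤1 e′≤1))
    (eq e e′ a₀ b₀ d₀ (size l) (size r) (2 ^ d₀))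
  where
  eq : ∀ e e′ a b d x y P → e + a + (e′ + b) + (P + (P + 0)) + (x + d + (y + d) + (1 + 1)) + 1
                            ≡ x + y + (suc d + suc d + 1) + (a + P + (b + P) + (e + e′))
  eq = solve-∀
... | inʳ A′ | inˡ B′ | inˡ F′ =
  ≤-by (d + 2) (+-mono-≤ (combʳ-full≤size b d l B′ F′) (combˡ-size A′)) (eq a b d (size l) (size r) (2 ^ d))
  where
  eq : ∀ a b d x y P → a + b + P + (x + d + y) + (d + 2) ≡ x + y + (d + d + 1) + (b + P + suc a)
  eq = solve-∀
... | inʳ A′ | inˡ B′ | inʳ F′ =
  ≤-by (d + 2) (+-mono-≤ (combˡ-full≤size a d r A′ F′) (combʳ-size B′)) (eq a b d (size l) (size r) (2 ^ d))
  where
  eq : ∀ a b d x y P → a + b + P + (y + d + x) + (d + 2) ≡ x + y + (d + d + 1) + (a + P + suc b)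
  eq = solve-∀
... | inʳ A′ | inˡ B′ | join d₀ refl F₁ F₂ =
  ≤-by 3 (+-mono-≤ (combʳ-full≤size b d₀ l B′ F₁) (combˡ-full≤size a d₀ r A′ F₂))
    (eq a b d₀ (size l) (size r) (2 ^ d₀))
  where
  eq : ∀ a b d x y P → a + b + (P + (P + 0)) + (x + d + (y + d)) + 3
                       ≡ x + y + (suc d + suc d + 1) + (b + P + (a + P))
  eq = solve-∀
... | inʳ A′ | inʳ e b₀ refl e≤1 _ B′ | inˡ F′ =
  ≤-by (d + d) (+-mono-≤ (+-mono-≤ (combs≤size a b₀ r A′ B′) (full-size d F′)) e≤1)
    (eq e a b₀ d (size l) (size r) (2 ^ d))
  where
  eq : ∀ e a b d x y P → a + (e + b) + P + (y + x + 1) + (d + d) ≡ x + y + (d + d + 1) + (a + b + P + e)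
  eq = solve-∀
... | inʳ A′ | inʳ e b₀ refl _ e≤l B′ | inʳ F′ =
  ≤-by 0 (+-mono-≤ (combs-full≤size a b₀ d r A′ B′ F′) e≤l) (eq e a b₀ d (size l) (size r) (2 ^ d))
  where
  eq : ∀ e a b d x y P → a + (e + b) + P + (y + (d + d + 1) + x) + 0 ≡ x + y + (d + d + 1) + (a + b + P + e)
  eq = solve-∀
... | inʳ A′ | inʳ e b₀ refl e≤1 _ B′ | join d₀ refl F₁ F₂ =
  ≤-by 1 (+-mono-≤ (+-mono-≤ (combs-full≤size a b₀ d₀ r A′ B′ F₂) (full-size d₀ F₁)) e≤1)
    (eq e a b₀ d₀ (size l) (size r) (2 ^ d₀))
  where
  eq : ∀ e a b d x y P → a + (e + b) + (P + (P + 0)) + (y + (d + d + 1) + x + 1) + 1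
                         ≡ x + y + (suc d + suc d + 1) + (a + b + P + P + e)
  eq = solve-∀

-- The lower bound

-- Families of sets, each represented by its upward closure Hit c.
record System (K q n s g : ℕ) : Set₁ where
  field
    Hit       : Fin q → Subset n → Set
    monotone  : ∀ {c p p′} → p ⊆ p′ → Hit c p → Hit c p′
    generated : ∀ {c p} → Hit c p → ∃ λ p′ → p′ ⊆ p × ∣ p′ ∣ ≤ g × Hit c p′
    rich      : ∀ {c p} → s ≤ ∣ p ∣ → Hit c p
    missed    : ∀ p → ∣ p ∣ ≤ K → ∃ λ c → ¬ Hit c p

-- The start of the induction: on fewer than `s` vertices the empty family is vacuously rich, and
-- every set misses it.
trivial : ∀ {K n s g} → n < s → System K 1 n s g
trivial n<s = record
  { Hit       = λ _ _ → ⊥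
  ; monotone  = λ _ ()
  ; generated = λ ()
  ; rich      = λ {_} {p} s≤ → contradiction (≤-trans s≤ (∣p∣≤n p)) (<⇒≱ n<s)
  ; missed    = λ _ _ → zero , λ ()
  }

restrict₁ : ∀ {K q n s g} → System K q (suc n) s g → System K q n s g
restrict₁ {n = n} S = record
  { Hit       = λ c p → Hit c (outside ∷ p)
  ; monotone  = λ p⊆p′ → monotone (s⊆s p⊆p′)
  ; generated = λ h → down (generated h)
  ; rich      = rich
  ; missed    = λ p → missed (outside ∷ p)
  }
  where
  open System S
  down : ∀ {c g p} → (∃ λ p′ → p′ ⊆ outside ∷ p × ∣ p′ ∣ ≤ g × Hit c p′) →
         ∃ λ (p′ : Subset n) → p′ ⊆ p × ∣ p′ ∣ ≤ g × Hit c (outside ∷ p′)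
  down (inside  ∷ p′ , p′⊆ , _) with () ← p′⊆ here
  down (outside ∷ p′ , p′⊆ , ∣p′∣ , h) = p′ , drop-∷-⊆ p′⊆ , ∣p′∣ , h

restrict : ∀ {K q n n′ s g} → n ≤′ n′ → System K q n′ s g → System K q n s g
restrict ≤′-refl          S = S
restrict (≤′-step n≤′n′) S = restrict n≤′n′ (restrict₁ S)

-- A new set is hit by the pair `(i , j)` if it has the shape `i`, or a path whose branching levels
-- are hit by `j`. Generators grow by one because a path branching at the levels `D` takes
-- `∣ D ∣ + 1` leaves; `big` says that `K` leaves cannot contain all three shapes.
stepUp : ∀ {K q n s g} c d r → 2 ≤ s → suc c ≤ g → 2 ^ d ≤ g → c ≤ suc r → d ≤ suc r →
         K + (d + d + 1) < c + c + 2 ^ d →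
         System K q n s g → System K (3 * q) (pow n) (s ^ suc r) (suc g)
stepUp {K} {q} {n} {s} {g} c d r 2≤s c<g 2^d≤g c≤r d≤r big S = record
  { Hit       = Hit′
  ; monotone  = λ p⊆p′ → Sum.map (Has-mono (toTree-mono n p⊆p′))
                                 (λ { (D , P , h) → D , Path-mono (toTree-mono n p⊆p′) P , h })
  ; generated = generated′
  ; rich      = rich′
  ; missed    = missed′
  }
  where
  open System S

  shape : Fin 3 → Shape
  shape zero             = combˡ c
  shape (suc zero)       = combʳ c
  shape (suc (suc zero)) = full d

  tips≤g : ∀ i → tips (shape i) ≤ g
  tips≤g zero             = subst (_≤ g) (sym (tips-combˡ c)) c<g
  tips≤g (suc zero)       = subst (_≤ g) (sym (tips-combʳ c)) c<g
  tips≤g (suc (suc zero)) = subst (_≤ g) (sym (tips-full d)) 2^d≤g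

  height≤r : ∀ i → height (shape i) ≤ suc r
  height≤r zero             = subst (_≤ suc r) (sym (height-combˡ c)) c≤r
  height≤r (suc zero)       = subst (_≤ suc r) (sym (height-combʳ c)) c≤r
  height≤r (suc (suc zero)) = subst (_≤ suc r) (sym (height-full d)) d≤r

  Hit″ : Fin 3 × Fin q → Subset (pow n) → Set
  Hit″ (i , j) p = Has (shape i) (toTree n p) ⊎ ∃ λ D → Path (toTree n p) D × Hit j D

  Hit′ : Fin (3 * q) → Subset (pow n) → Set
  Hit′ ij = Hit″ (remQuot q ij)

  generated′ : ∀ {ij p} → Hit′ ij p → ∃ λ p′ → p′ ⊆ p × ∣ p′ ∣ ≤ suc g × Hit′ ij p′
  generated′ {ij} (inj₁ h) with t , t⊑ , ∣t∣ , h′ ← Has-witness h =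
    fromTree t , fromTree⊆ n t⊑ ,
    ≤-trans (≤-reflexive (trans (∣fromTree∣ t) ∣t∣)) (≤-trans (tips≤g (proj₁ (remQuot {3} q ij))) (n≤1+n g)) ,
    inj₁ (subst (Has _) (sym (toTree∘fromTree t)) h′)
  generated′ (inj₂ (D , P , h))
    with D′ , D′⊆ , ∣D′∣ , h′ ← generated h
    with t , t⊑ , ∣t∣ , P′ ← Path-witness (Path-restrict D′ D′⊆ P) =
    fromTree t , fromTree⊆ n t⊑ ,
    ≤-trans (≤-reflexive (trans (∣fromTree∣ t) ∣t∣)) (s≤s ∣D′∣) ,
    inj₂ (D′ , subst (λ t → Path t D′) (sym (toTree∘fromTree t)) P′ , h′)

  rich″ : ∀ s → 2 ≤ s → (∀ {c p} → s ≤ ∣ p ∣ → Hit c p) → ∀ {ij p} → s ^ suc r ≤ ∣ p ∣ → Hit′ ij p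
  rich″ (suc h) 2≤s rich {ij} {p} s^r≤
    -- With neither a path of `s` branchings nor `full (suc r)` there would be at most `s ^ r`
    -- leaves, fewer than `s ^ suc r`.
    with path-or-full h r (toTree n p) (subst (suc h ^ r <_) (sym (size-toTree n p))
           (<-≤-trans (^-monoʳ-< (suc h) 2≤s (n<1+n r)) s^r≤))
  ... | inj₁ (D , P , h≤) = inj₂ (D , P , rich h≤)
  ... | inj₂ F            = inj₁ (full-universal _ (height≤r (proj₁ (remQuot {3} q ij))) F)

  rich′ : ∀ {ij p} → s ^ suc r ≤ ∣ p ∣ → Hit′ ij p
  rich′ = rich″ s 2≤s rich

  missingShape : ∀ (t : Tree n) → size t ≤ K → ∃ λ i → ¬ Has (shape i) t
  missingShape t ∣t∣≤K with has? (combˡ c) t | has? (combʳ c) t | has? (full d) t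
  ... | no ¬h | _     | _     = zero , ¬h
  ... | yes _ | no ¬h | _     = suc zero , ¬h
  ... | yes _ | yes _ | no ¬h = suc (suc zero) , ¬h
  ... | yes A | yes B | yes F = contradiction big
    (≤⇒≯ (≤-trans (combs-full≤size c c d t A B F) (+-monoˡ-≤ (d + d + 1) ∣t∣≤K)))

  missed′ : ∀ p → ∣ p ∣ ≤ K → ∃ λ ij → ¬ Hit′ ij p
  missed′ p ∣p∣≤K
    with i , ¬has ← missingShape (toTree n p) (≤-trans (≤-reflexive (size-toTree n p)) ∣p∣≤K)
    -- There are fewer than `K` branching levels unless the set is empty, so some old family misses
    -- them all; together with the absent shape it indexes a new family that misses `p`.
    with j , ¬hit ← missed (levels (toTree n p))
           (≤-trans (∣levels∣ (toTree n p)) (≤-trans pred[n]≤n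
             (≤-trans (≤-reflexive (size-toTree n p)) ∣p∣≤K))) =
    combine i j , λ h → case subst (λ ij → Hit″ ij p) (remQuot-combine i j) h of λ where
      (inj₁ has)         → ¬has has
      (inj₂ (D , P , h)) → ¬hit (monotone (Path⊆levels P) h)

-- Colour every edge by a family that it misses.
¬forces : ∀ {K q Q n t g} (ι : Fin q → Fin Q) → Injective _≡_ _≡_ ι →
          ⌈ K /2⌉ ≤ t → g ≤ ⌈ K /2⌉ → System K q n t g → ¬ Forces (balancedHedgehog K t) Q n
¬forces {K} {q} {Q} {n} {t} {g} ι ι-inj b≤t g≤b S forces = refute (forces (ι ∘ family))
  where
  open System S

  b = ⌈ K /2⌉

  family : n choose K → Fin q
  family (e , ∣e∣) = proj₁ (missed e (≤-reflexive ∣e∣))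

  family-missed : ∀ e → ¬ Hit (family e) (proj₁ e)
  family-missed (e , ∣e∣) = proj₂ (missed e (≤-reflexive ∣e∣))

  body : ∀ p → ∣ p ∣ ≤ b → ∃ λ (X : t choose b) → p ⊆ proj₁ X
  body p ∣p∣≤b with X , p⊆X , _ , ∣X∣ ← interpolate b p univ ⊆⊤ ∣p∣≤b (≤-trans b≤t (≤-reflexive (sym (∣⊤∣≡n t))))
    = (X , ∣X∣) , p⊆X

  X₀ : t choose b
  X₀ = proj₁ (body ∅ (≤-trans (≤-reflexive (∣⊥∣≡0 t)) z≤n))

  refute : ¬ ∃ λ (C : Copy (balancedHedgehog K t) (K[ n ] K)) → Monochromatic (ι ∘ family) C
  -- The common colour, read off at `X₀`, names a family that hits the body. A generator inside the
  -- body has at most `b` vertices, hence lies in some edge of the hedgehog; that edge has the same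
  -- colour but must miss the family.
  refute (C , mono) = unhit (generated (rich (≤-reflexive (sym (trans (∣image∣ f f-inj univ) (∣⊤∣≡n t))))))
    where
    open Copy C

    f : Fin t → Fin n
    f = onVertices ∘ inj₁

    f-inj : Injective _≡_ _≡_ f
    f-inj eq = inj₁-injective (injective eq)

    unhit : ¬ ∃ λ p → p ⊆ image f univ × ∣ p ∣ ≤ g × Hit (family (onEdges X₀)) p
    unhit (p , p⊆ , ∣p∣≤g , hit) = found (body (preimage f p) (≤-trans (∣preimage∣≤ f f-inj p) (≤-trans ∣p∣≤g g≤b)))
      where
      found : ¬ ∃ λ (X : t choose b) → preimage f p ⊆ proj₁ X
      found (X , ⊆X) = family-missed (onEdges X)
        (subst (λ c → Hit c (proj₁ (onEdges X))) (ι-inj (mono X₀ X))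
          (monotone (⊆-trans (⊆image f univ p⊆ ⊆X) (image⊆ f (proj₁ X) λ {i} i∈X →
            Equivalence.from (covers X (f i)) (inj₁ i , i∈X , refl))) hit))

-- Iterating the step-up and choosing the constants

⌈2k+1/2⌉≡1+k : ∀ k → ⌈ 2 * k + 1 /2⌉ ≡ suc k
⌈2k+1/2⌉≡1+k k = trans (cong ⌊_/2⌋ (eq k)) (sym (n≡⌊n+n/2⌋ (suc k)))
  where
  eq : ∀ k → suc (2 * k + 1) ≡ suc k + suc k
  eq = solve-∀

relax : ∀ {K q n s s′ g} → s ≤ s′ → System K q n s g → System K q n s′ g
relax s≤s′ S = record
  { Hit = Hit ; monotone = monotone ; generated = generated
  ; rich = λ s′≤ → rich (≤-trans s≤s′ s′≤) ; missed = missed }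
  where open System S

powers : ℕ → ℕ → ℕ
powers n zero    = n
powers n (suc i) = pow (powers n i)

-- The inequality `big` involves neither the number of vertices nor `s`, so the same three shapes
-- serve at every step, while the exponents `suc r` multiply.
systems : ∀ {K g} c d r s n → n < s → 2 ≤ s → suc c ≤ g → 2 ^ d ≤ g → c ≤ suc r → d ≤ suc r →
          K + (d + d + 1) < c + c + 2 ^ d →
          ∀ i → System K (3 ^ i) (powers n i) (s ^ suc r ^ i) (i + g)
systems c d r s n n<s _ _ _ _ _ _ zero = trivial (<-≤-trans n<s (≤-reflexive (sym (^-identityʳ s))))
systems {K} {g} c d r s@(suc _) n n<s 2≤s c<g 2^d≤g c≤r d≤r big (suc i) =
  subst (λ x → System K (3 ^ suc i) (powers n (suc i)) x (suc i + g))
    (trans (^-*-assoc s (suc r ^ i) (suc r)) (cong (s ^_) (*-comm (suc r ^ i) (suc r))))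
    (stepUp c d r (≤-trans 2≤s (≤-trans (≤-reflexive (sym (^-identityʳ s))) (^-monoʳ-≤ s (m^n>0 (suc r) i))))
      (≤-trans c<g (m≤n+m g i)) (≤-trans 2^d≤g (m≤n+m g i)) c≤r d≤r big
      (systems c d r s n n<s 2≤s c<g 2^d≤g c≤r d≤r big i))

-- The first exponential only leads from `n`, about the logarithm of `t`, back to `t`; so `m` steps
-- yield the tower of index `m`, which has `m - 1` exponentials above `t`.
tower≤powers : ∀ {n t} i → t ≤ 2 ^ n → tower (suc i) t ≤ powers n (suc i)
tower≤powers {n} zero    t≤ = ≤-trans t≤ (≤-reflexive (sym (pow≡2^ n)))
tower≤powers {n} (suc i) t≤ =
  ≤-trans (^-monoʳ-≤ 2 (tower≤powers i t≤)) (≤-reflexive (sym (pow≡2^ (powers n (suc i)))))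

-- Start from `n + 1` vertices and `s = n + 3`, where `n` is the integer part of the logarithm of
-- `t`. With `c = k - m` the generators after `m` steps have at most `m + suc c = k + 1` vertices,
-- as many as the body part of an edge; `d = 3 + m` lets the complete tree outweigh the tips that
-- combs of this length lack.
lowerBound : ∀ k → ∃ λ t₀ → ∀ t → t₀ ≤ t → ∀ m → 1 ≤ m → m + 2 ^ (3 + m) ≤ suc k →
             ∀ r → Forces (balancedHedgehog (2 * k + 1) t) (3 ^ k) r → tower m t ≤ r
-- The first summand gives `n ≥ n₀`, the second leaves room in the body for a set of `k + 1`
-- vertices. The exponent in `n₀` covers every `m ≤ k`, so the threshold does not depend on `m`.
lowerBound k = 2 ^ n₀ + suc k , bound
  where
  open ≤-Reasoning
  n₀ = proj₁ (polynomial≤exponential (suc k ^ k))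

  K<  : ∀ c m → 1 ≤ m → 2 * (m + c) + 1 + ((3 + m) + (3 + m) + 1) < c + c + 2 ^ (3 + m)
  K< c m 1≤m = begin-strict
    2 * (m + c) + 1 + ((3 + m) + (3 + m) + 1)   ≡⟨ eq₁ c m ⟩
    c + c + (8 + 4 * m)                         <⟨ +-monoʳ-< (c + c) (+-monoʳ-< 8 (*-monoˡ-< m {{>-nonZero 1≤m}} (m<m+n 4 {4} z<s))) ⟩
    c + c + (8 + 8 * m)                         ≡⟨ cong (c + c +_) (*-suc 8 m) ⟨
    c + c + 8 * suc m                           ≤⟨ +-monoʳ-≤ (c + c) (*-monoʳ-≤ 8 (n<2^n m)) ⟩
    c + c + 8 * 2 ^ m                           ≡⟨ cong (c + c +_) (eq₂ (2 ^ m)) ⟩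
    c + c + 2 ^ (3 + m)                         ∎
    where
    eq₁ : ∀ c m → 2 * (m + c) + 1 + ((3 + m) + (3 + m) + 1) ≡ c + c + (8 + 4 * m)
    eq₁ = solve-∀
    eq₂ : ∀ x → 8 * x ≡ 2 * (2 * (2 * x))
    eq₂ = solve-∀

  bound : ∀ t → 2 ^ n₀ + suc k ≤ t → ∀ m → 1 ≤ m → m + 2 ^ (3 + m) ≤ suc k →
          ∀ r → Forces (balancedHedgehog (2 * k + 1) t) (3 ^ k) r → tower m t ≤ r
  bound t t₀≤t m@(suc i) 1≤m m+2^≤ r forces = ≮⇒≥ λ r<tower →
    ¬forces (λ c → inject≤ c (^-monoʳ-≤ 3 m≤k)) (inject≤-injective _ _ _ _)
      (≤-trans (≤-reflexive (⌈2k+1/2⌉≡1+k k)) (m+n≤o⇒n≤o (2 ^ n₀) t₀≤t))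
      (≤-reflexive (trans (+-suc m c) (trans (cong suc (m+[n∸m]≡n m≤k)) (sym (⌈2k+1/2⌉≡1+k k)))))
      (restrict (≤⇒≤′ (≤-trans (<⇒≤ r<tower) (tower≤powers {suc n} i (<⇒≤ t<2^)))) (relax s≤t
        (systems {2 * k + 1} c (3 + m) k (3 + n) (suc n) (n≤1+n (2 + n)) (s≤s (s≤s z≤n)) ≤-refl 2^d≤ c≤1+k d≤1+k big m)))
      forces
    where
    d≤1+k : 3 + m ≤ suc k
    d≤1+k = ≤-trans (<⇒≤ (n<2^n (3 + m))) (m+n≤o⇒n≤o m m+2^≤)
    m≤k : m ≤ k
    m≤k = s≤s⁻¹ (≤-trans (+-monoˡ-≤ m (s≤s (z≤n {2}))) d≤1+k)
    c = k ∸ m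
    c≤1+k : c ≤ suc k
    c≤1+k = ≤-trans (m∸n≤m k m) (n≤1+n k)
    2^d≤ : 2 ^ (3 + m) ≤ suc c
    2^d≤ = +-cancelˡ-≤ m _ _ (≤-trans m+2^≤ (≤-reflexive (sym (trans (+-suc m c) (cong suc (m+[n∸m]≡n m≤k))))))
    big : 2 * k + 1 + ((3 + m) + (3 + m) + 1) < c + c + 2 ^ (3 + m)
    big = subst (λ k → 2 * k + 1 + ((3 + m) + (3 + m) + 1) < c + c + 2 ^ (3 + m)) (m+[n∸m]≡n m≤k) (K< c m 1≤m)
    1≤t : 1 ≤ t
    1≤t = ≤-trans (m^n>0 2 n₀) (m+n≤o⇒m≤o (2 ^ n₀) t₀≤t)
    n = proj₁ (log₂ t 1≤t)
    2^≤t = proj₁ (proj₂ (log₂ t 1≤t))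
    t<2^ = proj₂ (proj₂ (log₂ t 1≤t))
    n₀≤n : n₀ ≤ n
    n₀≤n = s≤s⁻¹ (≰⇒> λ n≤ → <⇒≱ t<2^ (≤-trans (^-monoʳ-≤ 2 n≤) (m+n≤o⇒m≤o (2 ^ n₀) t₀≤t)))
    s≤t : (3 + n) ^ suc k ^ m ≤ t
    s≤t = begin
      (3 + n) ^ suc k ^ m  ≤⟨ ^-monoʳ-≤ (3 + n) (^-monoʳ-≤ (suc k) m≤k) ⟩
      (3 + n) ^ suc k ^ k  ≤⟨ proj₂ (polynomial≤exponential (suc k ^ k)) n n₀≤n ⟩
      2 ^ n                ≤⟨ 2^≤t ⟩
      t                    ∎

-- Both summands are at most `2 ^ (m * 4)`, and one doubling is absorbed by the outer exponential.
-- The factor 4, the denominator of `c`, gives `3 + m ≤ m * 4`.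
height-bound : ∀ k m → 1 ≤ m → 2 ^ 2 ^ (m * 4) ≤ k → m + 2 ^ (3 + m) ≤ suc k
height-bound k m 1≤m ≤k = begin
  m + 2 ^ (3 + m)             ≤⟨ +-mono-≤ (≤-trans (m≤m*n m 4) (<⇒≤ (n<2^n (m * 4)))) (^-monoʳ-≤ 2 3+m≤) ⟩
  2 ^ (m * 4) + 2 ^ (m * 4)   ≡⟨ cong (2 ^ (m * 4) +_) (+-identityʳ _) ⟨
  2 ^ suc (m * 4)             ≤⟨ ^-monoʳ-≤ 2 (n<2^n (m * 4)) ⟩
  2 ^ 2 ^ (m * 4)             ≤⟨ ≤k ⟩
  k                           ≤⟨ n≤1+n k ⟩
  suc k                       ∎
  where
  open ≤-Reasoning
  3+m≤ : 3 + m ≤ m * 4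
  3+m≤ = ≤-trans (+-monoˡ-≤ m (*-monoʳ-≤ 3 1≤m)) (≤-reflexive (eq m))
    where
    eq : ∀ m → 3 * m + m ≡ m * 4
    eq = solve-∀

-- Decidability of Forces

-- A surjection from `Fin card` with a chosen section: enough for exhaustive search, by which the
-- least `n` that forces the hedgehog is found.
record Finite (A : Set) : Set where
  field
    card          : ℕ
    element       : Fin card → A
    index         : A → Fin card
    element-index : ∀ a → element (index a) ≡ a

  index-injective : Injective _≡_ _≡_ index
  index-injective {a} {b} eq = trans (sym (element-index a)) (trans (cong element eq) (element-index b))

  _≡?_ : (a b : A) → Dec (a ≡ b)
  a ≡? b = map′ index-injective (cong index) (index a ≟ᶠ index b)

  some? : ∀ {P : A → Set} → Decidable P → Dec (∃ P)
  some? {P} P? = map′ (λ { (i , p) → element i , p })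
    (λ { (a , p) → index a , subst P (sym (element-index a)) p }) (any? (P? ∘ element))

  every? : ∀ {P : A → Set} → Decidable P → Dec (∀ a → P a)
  every? {P} P? = map′ (λ p a → subst P (element-index a) (p (index a))) (λ p → p ∘ element) (all? (P? ∘ element))

open Finite

retract : ∀ {A B} (f : A → B) (g : B → A) → (∀ b → f (g b) ≡ b) → Finite A → Finite B
retract f g f∘g A = record
  { card = card A ; element = f ∘ element A ; index = index A ∘ g
  ; element-index = λ b → trans (cong f (element-index A (g b))) (f∘g b) }

finite-Fin : ∀ n → Finite (Fin n)
finite-Fin n = record { card = n ; element = id ; index = id ; element-index = λ _ → refl }

finite-⊎ : ∀ {A B} → Finite A → Finite B → Finite (A ⊎ B)
finite-⊎ A B = retract (Sum.map (element A) (element B) ∘ Inverse.to +↔⊎)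
  (Inverse.from (+↔⊎ {card A}) ∘ Sum.map (index A) (index B))
  (λ x → trans (cong (Sum.map (element A) (element B))
    (Inverse.strictlyInverseˡ (+↔⊎ {card A}) (Sum.map (index A) (index B) x))) (eq x))
  (finite-Fin (card A + card B))
  where
  eq : ∀ x → Sum.map (element A) (element B) (Sum.map (index A) (index B) x) ≡ x
  eq (inj₁ a) = cong inj₁ (element-index A a)
  eq (inj₂ b) = cong inj₂ (element-index B b)

finite-× : ∀ {A B} → Finite A → Finite B → Finite (A × B)
finite-× A B = retract (Product.map (element A) (element B) ∘ Inverse.to *↔×)
  (Inverse.from (*↔× {card A}) ∘ Product.map (index A) (index B))
  (λ x → trans (cong (Product.map (element A) (element B)) (Inverse.strictlyInverseˡ (*↔× {card A}) _))
               (cong₂ _,_ (element-index A (proj₁ x)) (element-index B (proj₂ x))))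
  (finite-Fin (card A * card B))

choose-≡ : ∀ {n m} {X Y : n choose m} → proj₁ X ≡ proj₁ Y → X ≡ Y
choose-≡ {X = X , p} {Y = .X , q} refl = cong (X ,_) (≡-irrelevant p q)

finite-choose : ∀ n m → Finite (n choose m)
finite-choose zero    zero    = retract (λ _ → [] , refl) (λ _ → zero) (λ { ([] , refl) → refl }) (finite-Fin 1)
finite-choose zero    (suc m) = retract (λ ()) (λ { ([] , ()) }) (λ { ([] , ()) }) (finite-Fin 0)
finite-choose (suc n) zero    = retract (λ { (X , p) → outside ∷ X , p }) (λ { (outside ∷ X , p) → X , p })
  (λ { (outside ∷ X , p) → refl }) (finite-choose n zero)
finite-choose (suc n) (suc m) = retract
  (λ { (inj₁ (X , p)) → inside ∷ X , cong suc p ; (inj₂ (X , p)) → outside ∷ X , p })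
  (λ { (inside ∷ X , p) → inj₁ (X , suc-injective p) ; (outside ∷ X , p) → inj₂ (X , p) })
  (λ { (inside ∷ X , p) → choose-≡ refl ; (outside ∷ X , p) → refl })
  (finite-⊎ (finite-choose n m) (finite-choose n (suc m)))

card-choose≤ : ∀ n m → card (finite-choose n m) ≤ n ^ m
card-choose≤ zero    zero    = ≤-refl
card-choose≤ zero    (suc m) = z≤n
card-choose≤ (suc n) zero    = card-choose≤ n zero
card-choose≤ (suc n) (suc m) = ≤-trans (+-mono-≤ (card-choose≤ n m) (card-choose≤ n (suc m)))
  (*-monoʳ-≤ (suc n) (^-monoˡ-≤ m (n≤1+n n)))

someVec? : ∀ {B} → Finite B → ∀ n {P : Vec B n → Set} → Decidable P → Dec (∃ P)
someVec? B zero    P? = map′ ([] ,_) (λ { ([] , p) → p }) (P? [])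
someVec? B (suc n) P? = map′ (λ { (b , bs , p) → b ∷ bs , p }) (λ { (b ∷ bs , p) → b , bs , p })
  (some? B λ b → someVec? B n λ bs → P? (b ∷ bs))

-- The search runs over tables of values, which determine a function only up to pointwise equality;
-- hence the hypothesis that `P` respects it.
someFunction? : ∀ {A B} → Finite A → Finite B → {P : (A → B) → Set} →
                (∀ {f g} → f ≗ g → P f → P g) → Decidable P → Dec (∃ P)
someFunction? A B {P} resp P? = map′
  (λ { (v , p) → lookup v ∘ index A , p })
  (λ { (f , p) → tabulate (f ∘ element A) , resp (λ a → sym (trans
    (lookup∘tabulate (f ∘ element A) (index A a)) (cong f (element-index A a)))) p })
  (someVec? B (card A) (λ v → P? (lookup v ∘ index A)))

module _ {k} (G : Hypergraph k) where
  private module G = Hypergraph G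

  record FiniteHypergraph : Set where
    field
      vertices : Finite G.Vertex
      edges    : Finite G.Edge
      _∈ᴳ?_    : ∀ v e → Dec (v G.∈ e)

module _ {k} {G : Hypergraph k} (finite : FiniteHypergraph G) (n : ℕ) where
  private
    module G = Hypergraph G
    module H = Hypergraph (K[ n ] k)
  open FiniteHypergraph finite

  Covers : (G.Vertex → Fin n) → (G.Edge → n choose k) → Set
  Covers f g = ∀ e w → w ∈ˢ proj₁ (g e) ⇔ ∃ λ v → v G.∈ e × f v ≡ w

  covers? : ∀ f g → Dec (Covers f g)
  covers? f g = every? edges λ e → every? (finite-Fin n) λ w →
    map′ (λ { (to , from) → mk⇔ to from }) (λ eq → Equivalence.to eq , Equivalence.from eq)
      ((w ∈? proj₁ (g e) →-dec image? e w) ×-dec (image? e w →-dec w ∈? proj₁ (g e)))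
    where
    image? : ∀ e w → Dec (∃ λ v → v G.∈ e × f v ≡ w)
    image? e w = some? vertices λ v → (v ∈ᴳ? e) ×-dec (f v ≟ᶠ w)

  module _ {q} (χ : Colouring (K[ n ] k) q) where

    IsMonoCopy : (G.Vertex → Fin n) → (G.Edge → n choose k) → Set
    IsMonoCopy f g = (∀ v w → f v ≡ f w → v ≡ w) × Covers f g × (∀ e e′ → χ (g e) ≡ χ (g e′))

    isMonoCopy? : ∀ f g → Dec (IsMonoCopy f g)
    isMonoCopy? f g =
      every? vertices (λ v → every? vertices λ w → (f v ≟ᶠ f w) →-dec _≡?_ vertices v w) ×-dec
      covers? f g ×-dec every? edges λ e → every? edges λ e′ → χ (g e) ≟ᶠ χ (g e′)

    isMonoCopy-resp : ∀ {f f′ g g′} → f ≗ f′ → g ≗ g′ → IsMonoCopy f g → IsMonoCopy f′ g′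
    isMonoCopy-resp {f} {f′} {g} {g′} f≗ g≗ (inj , cov , mono) =
      (λ v w eq → inj v w (trans (f≗ v) (trans eq (sym (f≗ w))))) ,
      (λ e w → subst (λ X → w ∈ˢ proj₁ X ⇔ ∃ λ v → v G.∈ e × f′ v ≡ w) (g≗ e) (mk⇔
        (λ w∈ → let v , v∈e , eq = Equivalence.to (cov e w) w∈ in v , v∈e , trans (sym (f≗ v)) eq)
        λ { (v , v∈e , eq) → Equivalence.from (cov e w) (v , v∈e , trans (f≗ v) eq) })) ,
      λ e e′ → trans (cong χ (sym (g≗ e))) (trans (mono e e′) (cong χ (g≗ e′)))

    MonoCopy : Set
    MonoCopy = ∃ λ (C : Copy G (K[ n ] k)) → Monochromatic χ C

    monoCopy? : Dec MonoCopy
    monoCopy? = map′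
      (λ { (f , g , inj , cov , mono) → record
        { onVertices = f ; injective = λ {v} {w} → inj v w ; onEdges = g ; covers = cov } , mono })
      (λ { (C , mono) → let open Copy C in onVertices , onEdges , (λ v w → injective) , covers , mono })
      (someFunction? vertices (finite-Fin n)
        (λ f≗ → λ { (g , c) → g , isMonoCopy-resp f≗ (λ _ → refl) c })
        λ f → someFunction? edges (finite-choose n k) (isMonoCopy-resp (λ _ → refl)) (isMonoCopy? f))

  forces? : ∀ q → Dec (Forces G q n)
  -- Search for a colouring without a monochromatic copy; if there is none, decidability of
  -- `MonoCopy` turns the double negation into a copy.
  forces? q = map′ (λ none χ → decidable-stable (monoCopy? χ) λ ¬c → none (χ , ¬c))
    (λ forces → λ { (χ , ¬c) → ¬c (forces χ) })
    (¬? (someFunction? (finite-choose n k) (finite-Fin q)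
      (λ χ≗ ¬c → λ { (C , mono) → ¬c (C , λ e e′ → trans (χ≗ _) (trans (mono e e′) (sym (χ≗ _)))) })
      λ χ → ¬? (monoCopy? χ)))

least : ∀ {P : ℕ → Set} → Decidable P → ∀ n → P n → ∃ λ r → P r × (∀ m → P m → r ≤ m) × r ≤ n
least P? n       Pn with P? 0
least P? n       Pn | yes P0 = 0 , P0 , (λ _ _ → z≤n) , z≤n
least P? zero    Pn | no ¬P0 = contradiction Pn ¬P0
least P? (suc n) Pn | no ¬P0 with r , Pr , min , r≤n ← least (P? ∘ suc) n Pn =
  suc r , Pr , (λ { zero P0 → contradiction P0 ¬P0 ; (suc m) Pm → s≤s (min m Pm) }) , s≤s r≤n

ramseyNumber≤ : ∀ {k} {G : Hypergraph k} → FiniteHypergraph G → ∀ q n → Forces G q n →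
                ∃ λ r → IsRamseyNumber G q r × r ≤ n
ramseyNumber≤ finite q n forces with r , Fr , min , r≤n ← least (λ m → forces? finite m q) n forces =
  r , (Fr , min) , r≤n

finite-hedgehog : ∀ k t → FiniteHypergraph (balancedHedgehog k t)
finite-hedgehog k t = record
  { vertices = finite-⊎ (finite-Fin t) (finite-× (finite-choose t ⌈ k /2⌉) (finite-Fin ⌊ k /2⌋))
  ; edges    = finite-choose t ⌈ k /2⌉
  ; _∈ᴳ?_    = λ { (inj₁ s) X → s ∈? proj₁ X ; (inj₂ (Y , _)) X → _≡?_ (finite-choose t ⌈ k /2⌉) Y X }
  }

-- The upper bound

partition : ∀ {n} {P Q : Fin n → Set} → (∀ v → P v ⊎ Q v) →
            ∃₂ λ W W′ → (∀ {v} → v ∈ˢ W → P v) × (∀ {v} → v ∈ˢ W′ → Q v) × ∣ W ∣ + ∣ W′ ∣ ≡ n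
partition {zero}  _ = [] , [] , (λ ()) , (λ ()) , refl
partition {suc n} P⊎Q with P⊎Q zero | partition (P⊎Q ∘ suc)
... | inj₁ p | W , W′ , P′ , Q′ , ∣∣ =
  inside ∷ W , outside ∷ W′ , (λ { here → p ; (there v∈) → P′ v∈ }) , (λ { (there v∈) → Q′ v∈ }) , cong suc ∣∣
... | inj₂ q | W , W′ , P′ , Q′ , ∣∣ =
  outside ∷ W , inside ∷ W′ , (λ { (there v∈) → P′ v∈ }) , (λ { here → q ; (there v∈) → Q′ v∈ }) ,
  trans (+-suc _ _) (cong suc ∣∣)

majority : ∀ {n} s {P Q : Fin n → Set} → (∀ v → P v ⊎ Q v) → s + s ≤ n →
           (∃ λ W → s ≤ ∣ W ∣ × (∀ {v} → v ∈ˢ W → P v)) ⊎ (∃ λ W → s ≤ ∣ W ∣ × (∀ {v} → v ∈ˢ W → Q v))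
majority s P⊎Q 2s≤n with W , W′ , P′ , Q′ , ∣∣ ← partition P⊎Q with s ≤? ∣ W ∣ | s ≤? ∣ W′ ∣
... | yes s≤ | _      = inj₁ (W , s≤ , P′)
... | no _   | yes s≤ = inj₂ (W′ , s≤ , Q′)
... | no s≰  | no s≰′ = contradiction 2s≤n (<⇒≱ (subst (_< s + s) ∣∣ (+-mono-< (≰⇒> s≰) (≰⇒> s≰′))))

remove : ∀ {n s d} (p q : Subset n) → ∣ q ∣ ≤ d → d + s ≤ ∣ p ∣ → s ≤ ∣ p ∩ ∁ q ∣
remove {s = s} {d} p q ∣q∣≤d d+s≤ = +-cancelʳ-≤ d _ _ (begin
  s + d                      ≡⟨ +-comm s d ⟩
  d + s                      ≤⟨ d+s≤ ⟩
  ∣ p ∣                      ≤⟨ ∣p∣≤∣p∩∁q∣+∣q∣ p q ⟩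
  ∣ p ∩ ∁ q ∣ + ∣ q ∣        ≤⟨ +-monoʳ-≤ _ ∣q∣≤d ⟩
  ∣ p ∩ ∁ q ∣ + d            ∎)
  where open ≤-Reasoning

-- Processing the vertices in increasing order, only the sets of earlier
-- vertices have to be avoided.
independent : ∀ {n} (Q : Fin n → Subset n → Set) d t (W : Subset n) →
              (∀ {v} → v ∈ˢ W → ∃ λ C → ∣ C ∣ ≤ d × Q v C) → t * suc d ≤ ∣ W ∣ →
              ∃ λ (f : Fin t → Fin n) → Injective _≡_ _≡_ f × (∀ i → f i ∈ˢ W) ×
                ∀ i → ∃ λ C → Q (f i) C × (∀ j → f i <ᶠ f j → f j ∉ˢ C)
independent Q d zero    W cover _   = (λ ()) , (λ { {()} }) , (λ ()) , λ ()
independent {n} Q d (suc t) W cover td≤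
  with v , v∈W , least ← leastElement W (≤-trans (s≤s z≤n) td≤)
  with C , ∣C∣ , q ← cover v∈W
  with f , f-inj , f∈W′ , f-indep ← independent Q d t (W ∩ ∁ (⁅ v ⁆ ∪ C)) (cover ∘ proj₁ ∘ x∈p∩q⁻ W _)
    -- Discarding `v` and `C` costs at most `suc d` vertices, the share of one step in `t * suc d`.
    (remove W (⁅ v ⁆ ∪ C) (≤-trans (∣∪∣≤ ⁅ v ⁆ C) (+-mono-≤ (≤-reflexive (∣⁅x⁆∣≡1 v)) ∣C∣)) td≤)
  = g , g-inj , g∈W , g-indep
  where
  f∈W : ∀ i → f i ∈ˢ W
  f∈W i = proj₁ (x∈p∩q⁻ W _ (f∈W′ i))

  f∉ : ∀ i → f i ∉ˢ ⁅ v ⁆ ∪ C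
  f∉ i = x∈∁p⇒x∉p (proj₂ (x∈p∩q⁻ W _ (f∈W′ i)))

  g : Fin (suc t) → Fin n
  g zero    = v
  g (suc i) = f i

  v≢f : ∀ i → v ≢ f i
  v≢f i v≡fi = f∉ i (x∈p∪q⁺ (inj₁ (subst (_∈ˢ ⁅ v ⁆) v≡fi (x∈⁅x⁆ v))))

  g-inj : Injective _≡_ _≡_ g
  g-inj {zero}  {zero}  _  = refl
  g-inj {zero}  {suc j} eq = contradiction eq (v≢f j)
  g-inj {suc i} {zero}  eq = contradiction (sym eq) (v≢f i)
  g-inj {suc i} {suc j} eq = cong suc (f-inj eq)

  g∈W : ∀ i → g i ∈ˢ W
  g∈W zero    = v∈W
  g∈W (suc i) = f∈W i

  g-indep : ∀ i → ∃ λ C → Q (g i) C × (∀ j → g i <ᶠ g j → g j ∉ˢ C)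
  g-indep zero    = C , q , λ { zero v<v → contradiction v<v (<-irrefl refl)
                            ; (suc j) _ fj∈C → f∉ j (x∈p∪q⁺ (inj₂ fj∈C)) }
  g-indep (suc i) with C′ , q′ , indep ← f-indep i =
    C′ , q′ , λ { zero fi<v → contradiction (least (f∈W i)) (<⇒≱ fi<v) ; (suc j) → indep j }

-- A maximal family of sets meeting only in v is either long or its union meets
-- every set outside v.
module _ {n} (v : Fin n) where

  DisjointOff : ∀ {L} → (Fin L → Subset n) → Set
  DisjointOff Y = ∀ {i j x} → i ≢ j → x ∈ˢ Y i → x ∈ˢ Y j → x ≡ v

  Covering : (Subset n → Set) → Subset n → Set
  Covering B C = ∀ {X} → B X → ∃ λ x → x ∈ˢ X × x ∈ˢ C × x ≢ v

  sunflowerOrCover : ∀ {B b} → Decidable B → (∀ {X} → B X → ∣ X ∣ ≤ b) → ∀ L →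
    (∃₂ λ C (Y : Fin L → Subset n) → ∣ C ∣ ≤ L * b × (∀ i → B (Y i)) × (∀ i → Y i ⊆ C) × DisjointOff Y) ⊎
    (∃ λ C → ∣ C ∣ ≤ L * b × Covering B C)
  sunflowerOrCover B? B≤b zero = inj₁ (∅ , (λ ()) , ≤-reflexive (∣⊥∣≡0 n) , (λ ()) , (λ ()) , λ { {()} })
  sunflowerOrCover {B} {b} B? B≤b (suc L) with sunflowerOrCover B? B≤b L
  ... | inj₂ (C , ∣C∣ , cov) = inj₂ (C , ≤-trans ∣C∣ (m≤n+m (L * b) b) , cov)
  -- `C` contains all sets chosen so far. Either some further set meets it at most in `v` and
  -- lengthens the family, or `C` is a covering.
  ... | inj₁ (C , Y , ∣C∣ , BY , Y⊆C , disjoint) with anySubset? (λ X → B? X ×-dec (X ∩ C ⊆? ⁅ v ⁆))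
  ...   | no ¬X = inj₂ (C , ≤-trans ∣C∣ (m≤n+m (L * b) b) , λ {X} BX → meets X BX)
    where
    meets : ∀ X → B X → ∃ λ x → x ∈ˢ X × x ∈ˢ C × x ≢ v
    meets X BX = decidable-stable (any? λ x → (x ∈? X) ×-dec (x ∈? C) ×-dec ¬? (x ≟ᶠ v)) λ ¬x →
      ¬X (X , BX , λ {x} x∈ → let x∈X , x∈C = x∈p∩q⁻ X C x∈ in
        subst (_∈ˢ ⁅ v ⁆) (sym (decidable-stable (x ≟ᶠ v) λ x≢v → ¬x (x , x∈X , x∈C , x≢v))) (x∈⁅x⁆ v))
  ...   | yes (X , BX , X∩C⊆) = inj₁ (X ∪ C , Y′ , ≤-trans (∣∪∣≤ X C) (+-mono-≤ (B≤b BX) ∣C∣) , BY′ , Y′⊆ , disjoint′)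
    where
    Y′ : Fin (suc L) → Subset n
    Y′ zero    = X
    Y′ (suc i) = Y i

    BY′ : ∀ i → B (Y′ i)
    BY′ zero    = BX
    BY′ (suc i) = BY i

    Y′⊆ : ∀ i → Y′ i ⊆ X ∪ C
    Y′⊆ zero    x∈ = x∈p∪q⁺ (inj₁ x∈)
    Y′⊆ (suc i) x∈ = x∈p∪q⁺ (inj₂ (Y⊆C i x∈))

    disjoint′ : DisjointOff Y′
    disjoint′ {zero}  {zero}  i≢j _   _   = contradiction refl i≢j
    disjoint′ {zero}  {suc j} i≢j x∈X x∈Y = x∈⁅y⁆⇒x≡y v (X∩C⊆ (x∈p∩q⁺ (x∈X , Y⊆C j x∈Y)))
    disjoint′ {suc i} {zero}  i≢j x∈Y x∈X = x∈⁅y⁆⇒x≡y v (X∩C⊆ (x∈p∩q⁺ (x∈X , Y⊆C i x∈Y)))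
    disjoint′ {suc i} {suc j} i≢j x∈i x∈j = disjoint (i≢j ∘ cong suc) x∈i x∈j

  Meets : ∀ {L} (U : Subset n) (Y : Fin L → Subset n) → Fin L → Set
  Meets U Y j = ∃ λ x → x ∈ˢ U × x ∈ˢ Y j × x ≢ v

  meets? : ∀ {L} U (Y : Fin L → Subset n) → Decidable (Meets U Y)
  meets? U Y j = any? λ x → (x ∈? U) ×-dec (x ∈? Y j) ×-dec ¬? (x ≟ᶠ v)

  -- Off `v` the sets `Y j` are disjoint, so picking a common element with `U` is injective in `j`.
  ∣meets∣≤ : ∀ {L} U (Y : Fin L → Subset n) → DisjointOff Y → ∣ comprehension (meets? U Y) ∣ ≤ ∣ U ∣
  ∣meets∣≤ U Y disjoint = injection⇒∣∣≤ _ U (λ j j∈ → let x , x∈U , _ = ∈-comprehension⁻ (meets? U Y) j∈ in x , x∈U)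
    λ i j i∈ j∈ eq → decidable-stable (i ≟ᶠ j) λ i≢j →
      let x , _ , x∈Yi , x≢v = ∈-comprehension⁻ (meets? U Y) i∈
          y , _ , y∈Yj , _   = ∈-comprehension⁻ (meets? U Y) j∈
      in x≢v (disjoint i≢j x∈Yi (subst (_∈ˢ Y j) (sym eq) y∈Yj))

-- Otherwise each pair `(i , j)` is encoded by `i` and the rank of `j` in `R i`, or by `j` and the
-- rank of `i` in `R′ j`. That gives `L * L ≤ L * u + L * u`, hence `L ≤ u + u`.
avoidingPair : ∀ {L u} (R R′ : Fin L → Subset L) → (∀ i → ∣ R i ∣ ≤ u) → (∀ j → ∣ R′ j ∣ ≤ u) → u + u < L →
               ∃₂ λ i j → j ∉ˢ R i × i ∉ˢ R′ j
avoidingPair {L} {u} R R′ R≤ R′≤ 2u<L =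
  decidable-stable (any? λ i → any? λ j → ¬? (j ∈? R i) ×-dec ¬? (i ∈? R′ j)) λ none →
    <⇒≱ 2u<L (*-cancelˡ-≤ L {{>-nonZero (≤-trans (s≤s z≤n) 2u<L)}}
      (≤-trans (L*L≤ (hit none)) (≤-reflexive (sym (*-distribˡ-+ L u u)))))
  where
  Hits : Set
  Hits = ∀ i j → j ∈ˢ R i ⊎ i ∈ˢ R′ j

  hit : ¬ (∃₂ λ i j → j ∉ˢ R i × i ∉ˢ R′ j) → Hits
  hit none i j with j ∈? R i | i ∈? R′ j
  ... | yes j∈ | _      = inj₁ j∈
  ... | no _   | yes i∈ = inj₂ i∈
  ... | no j∉  | no i∉  = contradiction (i , j , j∉ , i∉) none

  rank : (S : Subset L) → ∣ S ∣ ≤ u → ∀ {x} → x ∈ˢ S → Fin u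
  rank S ∣S∣≤u x∈ = inject≤ (Inverse.to (∈ˢ↔Fin S) (_ , x∈)) ∣S∣≤u

  rank-injective : ∀ S (∣S∣≤u : ∣ S ∣ ≤ u) {x y} (x∈ : x ∈ˢ S) (y∈ : y ∈ˢ S) →
                   rank S ∣S∣≤u x∈ ≡ rank S ∣S∣≤u y∈ → x ≡ y
  rank-injective S ∣S∣≤u x∈ y∈ eq =
    cong proj₁ (to-injective (∈ˢ↔Fin S) (inject≤-injective ∣S∣≤u ∣S∣≤u _ _ eq))

  encode : Hits → Fin L × Fin L → Fin L × Fin u ⊎ Fin L × Fin u
  encode h (i , j) = Sum.map (λ j∈ → i , rank (R i) (R≤ i) j∈) (λ i∈ → j , rank (R′ j) (R′≤ j) i∈) (h i j)

  encode-injective : ∀ h → Injective _≡_ _≡_ (encode h)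
  encode-injective h {i , j} {i′ , j′} eq with h i j | h i′ j′
  ... | inj₁ j∈ | inj₁ j∈′ with refl ← ,-injectiveˡ (inj₁-injective eq) =
    cong (i ,_) (rank-injective (R i) (R≤ i) j∈ j∈′ (,-injectiveʳ (inj₁-injective eq)))
  ... | inj₂ i∈ | inj₂ i∈′ with refl ← ,-injectiveˡ (inj₂-injective eq) =
    cong (_, j) (rank-injective (R′ j) (R′≤ j) i∈ i∈′ (,-injectiveʳ (inj₂-injective eq)))

  L*L≤ : Hits → L * L ≤ L * u + L * u
  L*L≤ h = injective⇒≤ {f = Inverse.from +↔⊎ ∘ Sum.map (Inverse.from *↔×) (Inverse.from *↔×) ∘ encode h ∘ Inverse.to *↔×}
    λ eq → to-injective *↔× (encode-injective h (map-injective (to-injective (↔-sym +↔⊎) eq)))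
    where
    map-injective : Injective _≡_ _≡_ (Sum.map (Inverse.from (*↔× {L} {u})) (Inverse.from (*↔× {L} {u})))
    map-injective {inj₁ _} {inj₁ _} eq = cong inj₁ (to-injective (↔-sym *↔×) (inj₁-injective eq))
    map-injective {inj₂ _} {inj₂ _} eq = cong inj₂ (to-injective (↔-sym *↔×) (inj₂-injective eq))

-- Bad sets of a two-colouring

module _ {K n} (χ : n choose K → Fin 2) where

  HasColour : Fin 2 → Subset n → Set
  HasColour c Z = ∃ λ (∣Z∣ : ∣ Z ∣ ≡ K) → χ (Z , ∣Z∣) ≡ c

  hasColour? : ∀ c → Decidable (HasColour c)
  hasColour? c Z with ∣ Z ∣ ≟ K
  ... | no ∣Z∣≢K = no (∣Z∣≢K ∘ proj₁)
  ... | yes ∣Z∣  = map′ (∣Z∣ ,_) (λ { (∣Z∣′ , eq) → trans (cong (λ e → χ (Z , e)) (≡-irrelevant ∣Z∣ ∣Z∣′)) eq })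
                     (χ (Z , ∣Z∣) ≟ᶠ c)

  -- `U` is an obstacle, such as the vertices already in use, that the new vertices of the edge have
  -- to avoid.
  Extends : Fin 2 → Subset n → Subset n → Set
  Extends c U X = ∃ λ Z → X ⊆ Z × Z ∩ U ⊆ X × HasColour c Z

  extends? : ∀ c U → Decidable (Extends c U)
  extends? c U X = anySubset? λ Z → (X ⊆? Z) ×-dec (Z ∩ U ⊆? X) ×-dec hasColour? c Z

  Bad : ℕ → Fin 2 → Subset n → Set
  Bad u c X = ∃ λ U → ∣ U ∣ ≤ u × ¬ Extends c U X

  bad? : ∀ u c → Decidable (Bad u c)
  bad? u c X = anySubset? λ U → (∣ U ∣ ≤? u) ×-dec ¬? (extends? c U X)

  ¬bad⇒extends : ∀ {u c X} → ¬ Bad u c X → ∀ U → ∣ U ∣ ≤ u → Extends c U X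
  ¬bad⇒extends {u} {c} {X} ¬bad U ∣U∣≤u = decidable-stable (extends? c U X) λ ¬ext → ¬bad (U , ∣U∣≤u , ¬ext)

  -- Complete `X ∪ X′` to an edge with vertices outside `U ∪ U′`, of which there are enough; the
  -- colour of this edge decides which alternative holds.
  extends-either : ∀ {u} X X′ U U′ → ∣ U ∣ ≤ u → ∣ U′ ∣ ≤ u → K + (u + u) ≤ n → ∣ X ∪ X′ ∣ ≤ K →
                   X′ ∩ U ⊆ X → X ∩ U′ ⊆ X′ → Extends zero U X ⊎ Extends (suc zero) U′ X′
  extends-either {u} X X′ U U′ ∣U∣ ∣U′∣ K+2u≤n ∣∪∣≤K X′∩U⊆X X∩U′⊆X′ = extend
    (interpolate K (X ∪ X′) ((X ∪ X′) ∪ ∁ (U ∪ U′)) (p⊆p∪q _) ∣∪∣≤K (≤-trans K≤ (∣q∣≤∣p∪q∣ (X ∪ X′) _)))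
    where
    open ≤-Reasoning
    K≤ : K ≤ ∣ ∁ (U ∪ U′) ∣
    K≤ = +-cancelʳ-≤ (u + u) _ _ (begin
      K + (u + u)                            ≤⟨ K+2u≤n ⟩
      n                                      ≤⟨ m≤n+m∸n n ∣ U ∪ U′ ∣ ⟩
      ∣ U ∪ U′ ∣ + (n ∸ ∣ U ∪ U′ ∣)          ≡⟨ cong (∣ U ∪ U′ ∣ +_) (∣∁p∣≡n∸∣p∣ (U ∪ U′)) ⟨
      ∣ U ∪ U′ ∣ + ∣ ∁ (U ∪ U′) ∣            ≤⟨ +-monoˡ-≤ _ (≤-trans (∣∪∣≤ U U′) (+-mono-≤ ∣U∣ ∣U′∣)) ⟩
      u + u + ∣ ∁ (U ∪ U′) ∣                 ≡⟨ +-comm (u + u) _ ⟩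
      ∣ ∁ (U ∪ U′) ∣ + (u + u)               ∎)

    extend : (∃ λ Z → X ∪ X′ ⊆ Z × Z ⊆ (X ∪ X′) ∪ ∁ (U ∪ U′) × ∣ Z ∣ ≡ K) →
             Extends zero U X ⊎ Extends (suc zero) U′ X′
    extend (Z , ⊆Z , Z⊆ , ∣Z∣) with χ (Z , ∣Z∣) in eq
    ... | zero = inj₁ (Z , ⊆Z ∘ p⊆p∪q X′ , avoid , ∣Z∣ , eq)
      where
      avoid : Z ∩ U ⊆ X
      avoid x∈ with x∈Z , x∈U ← x∈p∩q⁻ Z U x∈ with x∈p∪q⁻ (X ∪ X′) _ (Z⊆ x∈Z)
      ... | inj₂ x∈∁ = contradiction (p⊆p∪q U′ x∈U) (x∈∁p⇒x∉p x∈∁)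
      ... | inj₁ x∈X∪X′ = [ id , (λ x∈X′ → X′∩U⊆X (x∈p∩q⁺ (x∈X′ , x∈U))) ]′ (x∈p∪q⁻ X X′ x∈X∪X′)
    ... | suc zero = inj₂ (Z , ⊆Z ∘ q⊆p∪q X X′ , avoid , ∣Z∣ , eq)
      where
      avoid : Z ∩ U′ ⊆ X′
      avoid x∈ with x∈Z , x∈U ← x∈p∩q⁻ Z U′ x∈ with x∈p∪q⁻ (X ∪ X′) _ (Z⊆ x∈Z)
      ... | inj₂ x∈∁ = contradiction (q⊆p∪q U U′ x∈U) (x∈∁p⇒x∉p x∈∁)
      ... | inj₁ x∈X∪X′ = [ (λ x∈X → X∩U′⊆X′ (x∈p∩q⁺ (x∈X , x∈U))) , id ]′ (x∈p∪q⁻ X X′ x∈X∪X′)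

  RootedBad : ℕ → ℕ → Fin 2 → Fin n → Subset n → Set
  RootedBad b u c v X = ∣ X ∣ ≡ b × v ∈ˢ X × (∀ x → x ∈ˢ X → v ≤ᶠ x) × Bad u c X

  rootedBad? : ∀ b u c v → Decidable (RootedBad b u c v)
  rootedBad? b u c v X =
    (∣ X ∣ ≟ b) ×-dec (v ∈? X) ×-dec all? (λ x → (x ∈? X) →-dec (v ≤ᶠ? x)) ×-dec bad? u c X

  Covered : ℕ → ℕ → Fin 2 → Fin n → Set
  Covered b u c v = ∃ λ C → ∣ C ∣ ≤ suc (u + u) * b × Covering v (RootedBad b u c v) C

  -- Suppose both colours have sunflowers of length `2 u + 1` through `v`. By `avoidingPair` there
  -- is a set from each that meets the obstacle of the other at most in `v`. As they share `v`,
  -- their union has at most `2 b - 1 ≤ K` vertices, and `extends-either` contradicts the badness of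
  -- one of them.
  covered-either : ∀ b u → b + b ≤ suc K → K + (u + u) ≤ n → ∀ v → Covered b u zero v ⊎ Covered b u (suc zero) v
  covered-either b u 2b≤1+K K+2u≤n v
    with sunflowerOrCover v (rootedBad? b u zero v) (≤-reflexive ∘ proj₁) (suc (u + u))
       | sunflowerOrCover v (rootedBad? b u (suc zero) v) (≤-reflexive ∘ proj₁) (suc (u + u))
  ... | inj₂ cover | _ = inj₁ cover
  ... | inj₁ _ | inj₂ cover = inj₂ cover
  ... | inj₁ (_ , Y , _ , BY , _ , disjoint) | inj₁ (_ , Y′ , _ , BY′ , _ , disjoint′) =
    contradiction (avoidingPair
        (λ i → comprehension (meets? v (U i) Y′)) (λ j → comprehension (meets? v (U′ j) Y))
        (λ i → ≤-trans (∣meets∣≤ v (U i) Y′ disjoint′) (∣U∣ i))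
        (λ j → ≤-trans (∣meets∣≤ v (U′ j) Y disjoint) (∣U′∣ j))
        ≤-refl)
      λ { (i , j , j∉ , i∉) →
        [ ¬ext i , ¬ext′ j ]′ (extends-either (Y i) (Y′ j) (U i) (U′ j) (∣U∣ i) (∣U′∣ j) K+2u≤n
          (s≤s⁻¹ (≤-trans (∣∪∣< i j) 2b≤1+K))
          (λ {x} x∈ → let x∈Y′ , x∈U = x∈p∩q⁻ (Y′ j) (U i) x∈ in
            subst (_∈ˢ Y i) (sym (decidable-stable (x ≟ᶠ v) λ x≢v →
              j∉ (∈-comprehension⁺ (meets? v (U i) Y′) (x , x∈U , x∈Y′ , x≢v)))) (v∈ i))
          (λ {x} x∈ → let x∈Y , x∈U′ = x∈p∩q⁻ (Y i) (U′ j) x∈ in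
            subst (_∈ˢ Y′ j) (sym (decidable-stable (x ≟ᶠ v) λ x≢v →
              i∉ (∈-comprehension⁺ (meets? v (U′ j) Y) (x , x∈U′ , x∈Y , x≢v)))) (v∈′ j))) }
    where
    v∈ : ∀ i → v ∈ˢ Y i
    v∈ i = proj₁ (proj₂ (BY i))
    v∈′ : ∀ j → v ∈ˢ Y′ j
    v∈′ j = proj₁ (proj₂ (BY′ j))
    U U′ : Fin (suc (u + u)) → Subset n
    U i  = proj₁ (proj₂ (proj₂ (proj₂ (BY i))))
    U′ j = proj₁ (proj₂ (proj₂ (proj₂ (BY′ j))))
    ∣U∣ : ∀ i → ∣ U i ∣ ≤ u
    ∣U∣ i = proj₁ (proj₂ (proj₂ (proj₂ (proj₂ (BY i)))))
    ∣U′∣ : ∀ j → ∣ U′ j ∣ ≤ u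
    ∣U′∣ j = proj₁ (proj₂ (proj₂ (proj₂ (proj₂ (BY′ j)))))
    ¬ext : ∀ i → ¬ Extends zero (U i) (Y i)
    ¬ext i = proj₂ (proj₂ (proj₂ (proj₂ (proj₂ (BY i)))))
    ¬ext′ : ∀ j → ¬ Extends (suc zero) (U′ j) (Y′ j)
    ¬ext′ j = proj₂ (proj₂ (proj₂ (proj₂ (proj₂ (BY′ j)))))
    open ≤-Reasoning
    ∣∪∣< : ∀ i j → ∣ Y i ∪ Y′ j ∣ < b + b
    ∣∪∣< i j = begin-strict
      ∣ Y i ∪ Y′ j ∣                         <⟨ m<m+n _ (∈⇒1≤∣∣ (x∈p∩q⁺ (v∈ i , v∈′ j))) ⟩
      ∣ Y i ∪ Y′ j ∣ + ∣ Y i ∩ Y′ j ∣        ≡⟨ ∣∪∣+∣∩∣ (Y i) (Y′ j) ⟩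
      ∣ Y i ∣ + ∣ Y′ j ∣                     ≡⟨ cong₂ _+_ (proj₁ (BY i)) (proj₁ (BY′ j)) ⟩
      b + b                                  ∎

  Body : ℕ → ℕ → ℕ → Fin 2 → Set
  Body b u t c = ∃ λ (f : Fin t → Fin n) → Injective _≡_ _≡_ f × (∀ X → ∣ X ∣ ≡ b → ¬ Bad u c (image f X))

  -- Let `v` be the least vertex of a bad image. The cover chosen at `v` contains another vertex of
  -- the image, which is larger than `v` and was therefore excluded by `independent`.
  covered⇒body : ∀ {b u c} t → 1 ≤ b →
                 (∃ λ W → t * suc (suc (u + u) * b) ≤ ∣ W ∣ × (∀ {v} → v ∈ˢ W → Covered b u c v)) →
                 Body b u t c
  covered⇒body {b} {u} {c} t 1≤b (W , t≤ , covered)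
    with f , f-inj , _ , indep ← independent (λ v → Covering v (RootedBad b u c v)) (suc (u + u) * b) t W covered t≤ =
    f , f-inj , λ X ∣X∣ bad → refute X ∣X∣ bad
      (leastElement (image f X) (≤-trans 1≤b (≤-reflexive (sym (trans (∣image∣ f f-inj X) ∣X∣)))))
    where
    refute : ∀ X → ∣ X ∣ ≡ b → Bad u c (image f X) → ¬ (∃ λ v → v ∈ˢ image f X × (∀ {x} → x ∈ˢ image f X → v ≤ᶠ x))
    refute X ∣X∣ bad (v , v∈ , least)
      with i , _ , refl ← ∈-image⁻ f X v∈
      with C , covering , avoids ← indep i
      with x , x∈ , x∈C , x≢ ← covering (trans (∣image∣ f f-inj X) ∣X∣ , v∈ , (λ _ → least) , bad)
      with j , _ , refl ← ∈-image⁻ f X x∈ =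
      avoids j (≤∧≢⇒<ᶠ (least x∈) (x≢ ∘ sym)) x∈C

  body : ∀ b u t → 1 ≤ b → b + b ≤ suc K → K + (u + u) ≤ n →
         t * suc (suc (u + u) * b) + t * suc (suc (u + u) * b) ≤ n → ∃ (Body b u t)
  body b u t 1≤b 2b≤1+K K+2u≤n 2t≤n =
    [ (λ W → zero , covered⇒body t 1≤b W) , (λ W → suc zero , covered⇒body t 1≤b W) ]′
      (majority _ (covered-either b u 2b≤1+K K+2u≤n) 2t≤n)

  -- Every edge found joins the obstacle for the later ones, enlarging it by at most `K`, so the
  -- obstacle never exceeds `u`.
  greedy : ∀ {c u m} (X : Fin m → Subset n) U₀ → ∣ U₀ ∣ + m * K ≤ u →
           (∀ i U → ∣ U ∣ ≤ u → Extends c U (X i)) →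
           ∃ λ (Z : Fin m → Subset n) → (∀ i → X i ⊆ Z i × Z i ∩ U₀ ⊆ X i × HasColour c (Z i)) ×
             (∀ {i j x} → i ≢ j → x ∈ˢ Z i → x ∈ˢ Z j → x ∈ˢ X i ⊎ x ∈ˢ X j)
  greedy {m = zero}  X U₀ _ _ = (λ ()) , (λ ()) , λ { {()} }
  greedy {c} {u} {m = suc m} X U₀ ≤u ext with ext zero U₀ (m+n≤o⇒m≤o ∣ U₀ ∣ ≤u)
  ... | Z₀ , X⊆Z₀ , Z₀∩U₀⊆X , ∣Z₀∣ , χ₀
    with greedy {c} {u} (X ∘ suc) (U₀ ∪ Z₀)
           (≤-trans (+-monoˡ-≤ (m * K) (≤-trans (∣∪∣≤ U₀ Z₀) (+-monoʳ-≤ ∣ U₀ ∣ (≤-reflexive ∣Z₀∣))))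
           (≤-trans (≤-reflexive (+-assoc ∣ U₀ ∣ K (m * K))) ≤u)) (ext ∘ suc)
  ... | Z , spec , disjoint = Z′ , spec′ , disjoint′
    where
    Z′ : Fin (suc m) → Subset n
    Z′ zero    = Z₀
    Z′ (suc i) = Z i

    spec′ : ∀ i → X i ⊆ Z′ i × Z′ i ∩ U₀ ⊆ X i × HasColour c (Z′ i)
    spec′ zero    = X⊆Z₀ , Z₀∩U₀⊆X , ∣Z₀∣ , χ₀
    spec′ (suc i) = proj₁ (spec i) ,
      (λ x∈ → let x∈Z , x∈U₀ = x∈p∩q⁻ (Z i) U₀ x∈ in proj₁ (proj₂ (spec i)) (x∈p∩q⁺ (x∈Z , p⊆p∪q Z₀ x∈U₀))) ,
      proj₂ (proj₂ (spec i))

    -- A later edge treats `Z₀` as part of its obstacle, so it meets `Z₀` only inside its own body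
    -- part.
    later : ∀ i {x} → x ∈ˢ Z₀ → x ∈ˢ Z i → x ∈ˢ X (suc i)
    later i x∈Z₀ x∈Z = proj₁ (proj₂ (spec i)) (x∈p∩q⁺ (x∈Z , q⊆p∪q U₀ Z₀ x∈Z₀))

    disjoint′ : ∀ {i j x} → i ≢ j → x ∈ˢ Z′ i → x ∈ˢ Z′ j → x ∈ˢ X i ⊎ x ∈ˢ X j
    disjoint′ {zero}  {zero}  i≢j _  _  = contradiction refl i≢j
    disjoint′ {zero}  {suc j} _   x∈ y∈ = inj₂ (later j x∈ y∈)
    disjoint′ {suc i} {zero}  _   x∈ y∈ = inj₁ (later i y∈ x∈)
    disjoint′ {suc i} {suc j} i≢j x∈ y∈ = disjoint (i≢j ∘ cong suc) x∈ y∈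

-- Assembling the hedgehog from its edges

nth : ∀ {n m} (p : Subset n) → ∣ p ∣ ≡ m → Fin m → ∃ λ x → x ∈ˢ p
nth p refl = Inverse.from (∈ˢ↔Fin p)

nth-injective : ∀ {n m} (p : Subset n) (∣p∣ : ∣ p ∣ ≡ m) {i j} → proj₁ (nth p ∣p∣ i) ≡ proj₁ (nth p ∣p∣ j) → i ≡ j
nth-injective p refl eq = to-injective (↔-sym (∈ˢ↔Fin p)) (∃∈-≡ eq)

nth-surjective : ∀ {n m} (p : Subset n) (∣p∣ : ∣ p ∣ ≡ m) {x} → x ∈ˢ p → ∃ λ i → proj₁ (nth p ∣p∣ i) ≡ x
nth-surjective p refl x∈ = Inverse.to (∈ˢ↔Fin p) (_ , x∈) , cong proj₁ (Inverse.strictlyInverseʳ (∈ˢ↔Fin p) (_ , x∈))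

module _ {K n t : ℕ} (f : Fin t → Fin n) (f-inj : Injective _≡_ _≡_ f)
         (edge : t choose ⌈ K /2⌉ → n choose K)
         (body⊆ : ∀ X → image f (proj₁ X) ⊆ proj₁ (edge X))
         (∩body⊆ : ∀ X → proj₁ (edge X) ∩ image f univ ⊆ image f (proj₁ X))
         (disjoint : ∀ {X Y} → X ≢ Y → ∀ {x} → x ∈ˢ proj₁ (edge X) → x ∈ˢ proj₁ (edge Y) →
                     x ∈ˢ image f (proj₁ X) ⊎ x ∈ˢ image f (proj₁ Y)) where

  private
    -- By `∩body⊆` these vertices of the edge avoid the whole body; enumerated by `nth`, they become
    -- the edge's own vertices.
    spine : t choose ⌈ K /2⌉ → Subset n
    spine X = proj₁ (edge X) ∩ ∁ (image f (proj₁ X))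

    ∣spine∣ : ∀ X → ∣ spine X ∣ ≡ ⌊ K /2⌋
    ∣spine∣ X = +-cancelʳ-≡ ⌈ K /2⌉ _ _ (begin
      ∣ spine X ∣ + ⌈ K /2⌉                        ≡⟨ cong (∣ spine X ∣ +_) (trans (∣image∣ f f-inj (proj₁ X)) (proj₂ X)) ⟨
      ∣ spine X ∣ + ∣ image f (proj₁ X) ∣          ≡⟨ ∣∩∁∣+∣∣ (proj₁ (edge X)) (image f (proj₁ X)) (body⊆ X) ⟩
      ∣ proj₁ (edge X) ∣                           ≡⟨ proj₂ (edge X) ⟩
      K                                            ≡⟨ ⌊n/2⌋+⌈n/2⌉≡n K ⟨
      ⌊ K /2⌋ + ⌈ K /2⌉                            ∎)
      where open ≡-Reasoning

    V : Set
    V = Fin t ⊎ (t choose ⌈ K /2⌉ × Fin ⌊ K /2⌋)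

    vertex : V → Fin n
    vertex (inj₁ i)       = f i
    vertex (inj₂ (X , j)) = proj₁ (nth (spine X) (∣spine∣ X) j)

    vertex∈edge : ∀ X j → vertex (inj₂ (X , j)) ∈ˢ proj₁ (edge X)
    vertex∈edge X j = proj₁ (x∈p∩q⁻ (proj₁ (edge X)) _ (proj₂ (nth (spine X) (∣spine∣ X) j)))

    vertex∉body : ∀ X j → vertex (inj₂ (X , j)) ∉ˢ image f (proj₁ X)
    vertex∉body X j = x∈∁p⇒x∉p (proj₂ (x∈p∩q⁻ (proj₁ (edge X)) _ (proj₂ (nth (spine X) (∣spine∣ X) j))))

    vertex≢body : ∀ i X j → f i ≢ vertex (inj₂ (X , j))
    vertex≢body i X j eq = vertex∉body X j (∩body⊆ X (x∈p∩q⁺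
      (vertex∈edge X j , subst (_∈ˢ image f univ) eq (∈-image⁺ f ∈⊤))))

    same-edge : ∀ X i Y j → vertex (inj₂ (X , i)) ≡ vertex (inj₂ (Y , j)) → X ≡ Y
    same-edge X i Y j eq = decidable-stable (_≡?_ (finite-choose t ⌈ K /2⌉) X Y) λ X≢Y →
      [ vertex∉body X i , (λ x∈ → vertex∉body Y j (subst (_∈ˢ image f (proj₁ Y)) eq x∈)) ]′
        (disjoint X≢Y (vertex∈edge X i) (subst (_∈ˢ proj₁ (edge Y)) (sym eq) (vertex∈edge Y j)))

    vertex-injective : ∀ v w → vertex v ≡ vertex w → v ≡ w
    vertex-injective (inj₁ i)       (inj₁ j)       eq = cong inj₁ (f-inj eq)
    vertex-injective (inj₁ i)       (inj₂ (Y , j)) eq = contradiction eq (vertex≢body i Y j)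
    vertex-injective (inj₂ (X , i)) (inj₁ j)       eq = contradiction (sym eq) (vertex≢body j X i)
    vertex-injective (inj₂ (X , i)) (inj₂ (Y , j)) eq with refl ← same-edge X i Y j eq =
      cong (λ j → inj₂ (X , j)) (nth-injective (spine X) (∣spine∣ X) eq)

    open Hypergraph (balancedHedgehog K t) using () renaming (_∈_ to _∈ᴴ_)

    edge⇒vertex : ∀ X x → x ∈ˢ proj₁ (edge X) → ∃ λ v → v ∈ᴴ X × vertex v ≡ x
    edge⇒vertex X x x∈ with x ∈? image f (proj₁ X)
    ... | yes x∈f = let i , i∈X , eq = ∈-image⁻ f (proj₁ X) x∈f in inj₁ i , i∈X , eq
    ... | no x∉f  = let j , eq = nth-surjective (spine X) (∣spine∣ X) (x∈p∩q⁺ (x∈ , x∉p⇒x∈∁p x∉f))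
                    in inj₂ (X , j) , refl , eq

    vertex⇒edge : ∀ X v → v ∈ᴴ X → vertex v ∈ˢ proj₁ (edge X)
    vertex⇒edge X (inj₁ i)       i∈X  = body⊆ X (∈-image⁺ f i∈X)
    vertex⇒edge X (inj₂ (_ , j)) refl = vertex∈edge X j

  hedgehogCopy : Copy (balancedHedgehog K t) (K[ n ] K)
  hedgehogCopy = record
    { onVertices = vertex
    ; injective  = λ {v} {w} → vertex-injective v w
    ; onEdges    = edge
    ; covers     = λ X x → mk⇔ (edge⇒vertex X x)
        λ { (v , v∈ , eq) → subst (_∈ˢ proj₁ (edge X)) eq (vertex⇒edge X v v∈) }
    }

-- `u` bounds the vertices ever in use: `t` for the body and `K` for each of at most `t ^ ⌈ K /2⌉`
-- edges. The last inequality lets half of the vertices supply a body although each choice discards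
-- a cover.
hedgehogForced : ∀ {K n t u} → 1 ≤ ⌈ K /2⌉ → ⌈ K /2⌉ + ⌈ K /2⌉ ≤ suc K →
                 t + t ^ ⌈ K /2⌉ * K ≤ u → K + (u + u) ≤ n →
                 t * suc (suc (u + u) * ⌈ K /2⌉) + t * suc (suc (u + u) * ⌈ K /2⌉) ≤ n →
                 Forces (balancedHedgehog K t) 2 n
hedgehogForced {K} {n} {t} {u} 1≤b 2b≤1+K u≥ K+2u≤n 2t≤n χ
  with c , f , f-inj , ¬bad ← body χ ⌈ K /2⌉ u t 1≤b 2b≤1+K K+2u≤n 2t≤n =
  build (greedy χ X (image f univ) room
    (λ i → ¬bad⇒extends χ (¬bad (proj₁ (element E i)) (proj₂ (element E i)))))
  where
  b = ⌈ K /2⌉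
  E = finite-choose t b

  X : Fin (card E) → Subset n
  X i = image f (proj₁ (element E i))

  room : ∣ image f univ ∣ + card E * K ≤ u
  room = ≤-trans (+-mono-≤ (≤-reflexive (trans (∣image∣ f f-inj univ) (∣⊤∣≡n t)))
                           (*-monoˡ-≤ K (card-choose≤ t b))) u≥

  build : (∃ λ (Z : Fin (card E) → Subset n) →
            (∀ i → X i ⊆ Z i × Z i ∩ image f univ ⊆ X i × HasColour χ c (Z i)) ×
            (∀ {i j x} → i ≢ j → x ∈ˢ Z i → x ∈ˢ Z j → x ∈ˢ X i ⊎ x ∈ˢ X j)) →
          ∃ λ (C : Copy (balancedHedgehog K t) (K[ n ] K)) → Monochromatic χ C
  build (Z , spec , disjoint) = hedgehogCopy {K} f f-inj edge body⊆ ∩body⊆ disjoint′ ,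
    λ X Y → trans (proj₂ (proj₂ (proj₂ (spec (index E X))))) (sym (proj₂ (proj₂ (proj₂ (spec (index E Y))))))
    where
    edge : t choose b → n choose K
    edge X = Z (index E X) , proj₁ (proj₂ (proj₂ (spec (index E X))))

    body≡ : ∀ Y → X (index E Y) ≡ image f (proj₁ Y)
    body≡ Y = cong (image f ∘ proj₁) (element-index E Y)

    body⊆ : ∀ X → image f (proj₁ X) ⊆ Z (index E X)
    body⊆ X = subst (_⊆ Z (index E X)) (body≡ X) (proj₁ (spec (index E X)))

    ∩body⊆ : ∀ X → Z (index E X) ∩ image f univ ⊆ image f (proj₁ X)
    ∩body⊆ X = subst (Z (index E X) ∩ image f univ ⊆_) (body≡ X) (proj₁ (proj₂ (spec (index E X))))

    disjoint′ : ∀ {X Y} → X ≢ Y → ∀ {x} → x ∈ˢ Z (index E X) → x ∈ˢ Z (index E Y) →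
                x ∈ˢ image f (proj₁ X) ⊎ x ∈ˢ image f (proj₁ Y)
    disjoint′ {X} {Y} X≢Y {x} x∈ x∈′ =
      Sum.map (subst (x ∈ˢ_) (body≡ X)) (subst (x ∈ˢ_) (body≡ Y)) (disjoint (X≢Y ∘ index-injective E) x∈ x∈′)

-- For fixed `K` the construction takes on the order of `t ^ (1 + ⌈ K /2⌉)` vertices; the remaining
-- factor `t` absorbs the constant.
upperBound : ∀ K → 1 ≤ ⌈ K /2⌉ → ∃ λ t₀ → ∀ t → t₀ ≤ t → Forces (balancedHedgehog K t) 2 (t ^ (2 + ⌈ K /2⌉))
-- The first summand exceeds the factor `3 K + 2` in `room`; `a + a` is the constant in twice the
-- number of vertices that the choice of the body consumes.
upperBound K 1≤b = suc (K + K + (K + 2)) + (a + a) , bound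
  where
  open ≤-Reasoning
  b = ⌈ K /2⌉
  a = suc ((K + K + 3) * b)

  2b≤1+K : b + b ≤ suc K
  2b≤1+K = ≤-trans (+-monoʳ-≤ b (⌊n/2⌋≤⌈n/2⌉ (suc K))) (≤-reflexive (⌊n/2⌋+⌈n/2⌉≡n (suc K)))

  bound : ∀ t → suc (K + K + (K + 2)) + (a + a) ≤ t → Forces (balancedHedgehog K t) 2 (t ^ (2 + b))
  bound t@(suc _) t₀≤t = hedgehogForced {K} {u = u} 1≤b 2b≤1+K (+-monoˡ-≤ (p * K) t≤p) room (begin
    t * suc (suc (u + u) * b) + t * suc (suc (u + u) * b)    ≤⟨ +-mono-≤ (*-monoʳ-≤ t step) (*-monoʳ-≤ t step) ⟩
    t * (p * a) + t * (p * a)                                ≡⟨ eq₃ t p a ⟩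
    t * ((a + a) * p)                                        ≤⟨ *-monoʳ-≤ t (*-monoˡ-≤ p 2a≤t) ⟩
    t * (t * p)                                              ∎)
    where
    p = t ^ b
    u = p + p * K
    2a≤t : a + a ≤ t
    2a≤t = m+n≤o⇒n≤o (suc (K + K + (K + 2))) t₀≤t
    1≤p : 1 ≤ p
    1≤p = m^n>0 t b
    t≤p : t ≤ p
    t≤p = ≤-trans (≤-reflexive (sym (^-identityʳ t))) (^-monoʳ-≤ t 1≤b)
    eq₁ : ∀ p K → K * p + (p + p * K + (p + p * K)) ≡ (K + K + (K + 2)) * p
    eq₁ = solve-∀
    eq₂ : ∀ p K b → p + (p + (p + p * K + (p + p * K))) * b ≡ p * suc ((K + K + 3) * b)
    eq₂ = solve-∀
    eq₃ : ∀ t p a → t * (p * a) + t * (p * a) ≡ t * ((a + a) * p)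
    eq₃ = solve-∀
    room : K + (u + u) ≤ t * (t * p)
    room = begin
      K + (u + u)                   ≤⟨ +-monoˡ-≤ (u + u) (m≤m*n K p {{>-nonZero 1≤p}}) ⟩
      K * p + (u + u)               ≡⟨ eq₁ p K ⟩
      (K + K + (K + 2)) * p         ≤⟨ *-monoˡ-≤ p (≤-trans (n≤1+n _) (≤-trans (m≤m+n _ (a + a)) t₀≤t)) ⟩
      t * p                         ≤⟨ m≤n*m (t * p) t ⟩
      t * (t * p)                   ∎
    step : suc (suc (u + u) * b) ≤ p * a
    step = begin
      suc (suc (u + u) * b)         ≤⟨ +-mono-≤ 1≤p (*-monoˡ-≤ b (+-monoˡ-≤ (u + u) 1≤p)) ⟩
      p + (p + (u + u)) * b         ≡⟨ eq₂ p K b ⟩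
      p * a                         ∎

theorem1p2 : ∃ λ (c : ℚ) → 0ℚ <ℚ c ×
    ∃ λ (q : ℕ → ℕ) →
    ∀ (k : ℕ) → 1 ≤ k →
    ∃ λ (t₀ : ℕ) → ∀ (t : ℕ) → t₀ ≤ t →
    (∃ λ (r : ℕ) → IsRamseyNumber (balancedHedgehog (2 * k + 1) t) 2 r × r ≤ t ^ (k + 3))
    ×
    (2 ≤ k → ∀ (m : ℕ) → m ≡⌊ c *log₂log₂ k ⌋ → 1 ≤ m →
    ∀ (r : ℕ) → IsRamseyNumber (balancedHedgehog (2 * k + 1) t) (q k) r → tower m t ≤ r)
-- With `c = 1/4` one has `m ≤ k`, so the `3 ^ m` families of `m` steps fit into `3 ^ k` colours.
theorem1p2 = pos 1 /ℚ 4 , toWitness {a? = 0ℚ <ℚ? pos 1 /ℚ 4} _ , (3 ^_) , λ k _ →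
  let t₁ , upper = upperBound (2 * k + 1) (subst (1 ≤_) (sym (⌈2k+1/2⌉≡1+k k)) (s≤s z≤n))
      t₂ , lower = lowerBound k
      exponent   = trans (cong (2 +_) (⌈2k+1/2⌉≡1+k k)) (+-comm 3 k)
  in t₁ + t₂ , λ t t₀≤t →
    ramseyNumber≤ (finite-hedgehog (2 * k + 1) t) 2 (t ^ (k + 3))
      (subst (λ e → Forces (balancedHedgehog (2 * k + 1) t) 2 (t ^ e)) exponent
        (upper t (m+n≤o⇒m≤o t₁ t₀≤t))) ,
    λ _ m (m≤ , _) 1≤m r (forces , _) →
      lower t (m+n≤o⇒n≤o t₁ t₀≤t) m 1≤m
        -- For `c = 1/4` the relation concerns the real number `2 ^ (4 m)`, an integer, which is
        -- tested as the rational with denominator 1.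
        (height-bound k m 1≤m (subst (2 ^ 2 ^ (m * 4) ≤_) (*-identityʳ k)
          (m≤ (2 ^ (m * 4)) 1 ≤-refl)))
        r forces
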